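{- Let $\mathcal B$ be a finite set of simple $k$-SAT formulae and let $m(\mathcal B)=\max_{B\in\mathcal B}|B|$. For every $\delta>0$ there exists $C=C(\mathcal B,\delta)>0$ such that for every $n$ there is a collection $\mathcal G$ of formulae on the variable set $X=\{x_1,\dots,x_n\}$ satisfying: (a) every $\mathcal B$-free $k$-SAT formula with variables in $X$ is a subformula of some $G\in\mathcal G$; (b) for every $G\in\mathcal G$ and $B\in\mathcal B$, $G$ has at most $\delta n^{v(B)}$ copies of $B$; (c) $|\mathcal G|\le n^{Cn^{k-1/(m(\mathcal B)-1)}}$.
   Context: A clause is a conjunction of $k$ literals ($x$ or $\overline x$) on $k$ distinct variables; a $k$-SAT formula is a set of clauses; $|B|$ denotes its number of clauses and $v(B)$ the number of variables appearing in some clause of $B$. A formula is simple if no two of its clauses use exactly the same set of $k$ variables. A subformula is a subset of clauses; two formulae are isomorphic if one is obtained from the other by relabeling variables; a copy of $B$ in $G$ is a subformula of $G$ isomorphic to $B$; $G$ is $\mathcal B$-free if it contains no copy of any $B\in\mathcal B$. -}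

module Defs where

open import Data.Nat using (ℕ; zero; suc; _+_; _*_; _∸_; _^_; _≤_; _<_; _⊔_)
open import Data.Bool using (Bool; true; false; _∧_; if_then_else_)
open import Data.Maybe using (Maybe; just; nothing; is-just)
open import Data.Vec using (Vec; []; _∷_; lookup; tabulate)
open import Data.List using (List; []; _∷_; length; filterᵇ; concatMap; map; foldr; allFin)
open import Data.List.Relation.Unary.All using (All)
open import Data.List.Relation.Unary.AllPairs using (AllPairs)
open import Data.List.Membership.Propositional using (_∈_)
open import Data.Bool.ListAction using (any)
open import Data.Fin using (Fin; _≟_)
open import Data.Product using (Σ; ∃; ∃-syntax; _×_; proj₁; proj₂)
open import Relation.Nullary using (¬_; ⌊_⌋)
open import Relation.Binary.PropositionalEquality using (_≡_; _≢_)

-- A (potential) clause on variables x_0..x_{n-1}: entry i is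
--   nothing    : x_i does not occur,
--   just true  : literal x_i,
--   just false : literal ¬x_i.
-- (A clause uses each variable at most once, so this representation is canonical.)
Clause : ℕ → Set
Clause n = Vec (Maybe Bool) n

width : ∀ {n} → Clause n → ℕ
width [] = 0
width (nothing ∷ c) = width c
width (just _ ∷ c) = suc (width c)

-- a formula on variables Fin n is a (finite) set of clauses, given by its
-- characteristic function
Formula : ℕ → Set
Formula n = Clause n → Bool

IsKSAT : ℕ → ∀ {n} → Formula n → Set
IsKSAT k F = ∀ c → F c ≡ true → width c ≡ k

allClauses : (n : ℕ) → List (Clause n)
allClauses zero = [] ∷ []
allClauses (suc n) =
  concatMap (λ c → (nothing ∷ c) ∷ (just true ∷ c) ∷ (just false ∷ c) ∷ [])
            (allClauses n)

size : ∀ {n} → Formula n → ℕ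
size {n} F = length (filterᵇ F (allClauses n))

usesVar : ∀ {n} → Formula n → Fin n → Bool
usesVar {n} F i = any (λ c → F c ∧ is-just (lookup c i)) (allClauses n)

numVars : ∀ {n} → Formula n → ℕ
numVars {n} F = length (filterᵇ (usesVar F) (allFin n))

_⊆F_ : ∀ {n} → Formula n → Formula n → Set
F ⊆F G = ∀ c → F c ≡ true → G c ≡ true

Simple : ∀ {n} → Formula n → Set
Simple F = ∀ c c' → F c ≡ true → F c' ≡ true →
           (∀ i → is-just (lookup c i) ≡ is-just (lookup c' i)) → c ≡ c'

firstJust : {A : Set} → List (Maybe A) → Maybe A
firstJust [] = nothing
firstJust (just a ∷ _) = just a
firstJust (nothing ∷ xs) = firstJust xs

-- rename the variables of a clause along σ (meaningful when σ is injective on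
-- the variables of the clause)
rename : ∀ {a b} → (Fin a → Fin b) → Clause a → Clause b
rename {a} σ c = tabulate (λ j →
  firstJust (map (λ i → if ⌊ σ i ≟ j ⌋ then lookup c i else nothing) (allFin a)))

Relabels : ∀ {a b} → Formula a → Formula b → Set
Relabels {a} {b} B S = Σ (Fin a → Fin b) λ σ →
  (∀ i j → usesVar B i ≡ true → usesVar B j ≡ true → σ i ≡ σ j → i ≡ j) ×
  (∀ c → (S c ≡ true → ∃[ c' ] (B c' ≡ true × rename σ c' ≡ c)) ×
         ((∃[ c' ] (B c' ≡ true × rename σ c' ≡ c)) → S c ≡ true))

IsCopy : ∀ {a n} → Formula a → Formula n → Formula n → Set
IsCopy B G S = (S ⊆F G) × Relabels B S

AnyFormula : Set
AnyFormula = Σ ℕ Formula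

Free : List AnyFormula → ∀ {n} → Formula n → Set
Free 𝓑 G = ∀ B → B ∈ 𝓑 → ∀ S → ¬ IsCopy (proj₂ B) G S

DifferentF : ∀ {n} → Formula n → Formula n → Set
DifferentF S S' = ∃[ c ] (S c ≢ S' c)

-- "G has at most (p/q) · n^{v(B)} copies of B": any list of pairwise
-- different copies of B in G has length L with q·L ≤ p·n^{v(B)}
CopiesBound : ℕ → ℕ → (B : AnyFormula) → ∀ {n} → Formula n → Set
CopiesBound p q B {n} G =
  ∀ (L : List (Formula n)) → All (IsCopy (proj₂ B) G) L → AllPairs DifferentF L →
  q * length L ≤ p * n ^ numVars (proj₂ B)

maxSize : List AnyFormula → ℕ
maxSize = foldr (λ B r → size (proj₂ B) ⊔ r) 0

-- PowBound C k m n N  expresses  N ≤ n^(C · n^(k - 1/(m-1)))  (for n ≥ 1, m ≥ 2)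
-- without real numbers: N^a ≤ n^b for every rational b/a (a ≥ 1) strictly above
-- the exponent t = C·n^(k-1/(m-1)), where b/a > t ⇔ b^(m-1) > (C a)^(m-1) · n^(k(m-1)-1).
PowBound : ℕ → ℕ → ℕ → ℕ → ℕ → Set
PowBound C k m n N =
  ∀ a b → 1 ≤ a → (C * a) ^ (m ∸ 1) * n ^ (k * (m ∸ 1) ∸ 1) < b ^ (m ∸ 1) →
  N ^ a ≤ n ^ b

{-# OPTIONS --safe #-}

-- Copies of B become tuples of clauses, i.e. edges of a multihypergraph H on the clauses of width k.
-- If H is dense, a B-free F is located by a decision tree.  Alongside H one grows a hypergraph H′ of
-- tails of edges whose head is known to lie in F; F is then independent in H′ as well.  Tails are
-- added only while no partial tuple becomes too frequent in H′.  As long as H′ is not dense, most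
-- edges of H may still be used, so a positive proportion of the clauses are useful heads: either F
-- contains one of them, and H′ grows by a definite amount, or F avoids them all, and the container
-- loses a positive proportion of all clauses.  Once H′ is dense, recurse on the shorter tuples.
-- Each grown hypergraph costs O(n ^ k / t) known clauses, where t ≈ n ^ (1 / (m ∸ 1)); the degree
-- condition needed for this holds because two clauses of a simple formula span more than k variables.

module Submission where

open import Defs
open import Algebra.Properties.CommutativeSemigroup using (interchange)
open import Data.Bool using (Bool; true; false; _∧_; _∨_; not; T; if_then_else_) renaming (_≟_ to _≟ᵇ_)
open import Data.Bool.ListAction using (any)
open import Data.Bool.Properties using (T-≡; T?)
open import Data.Empty using (⊥-elim)
open import Data.Fin using (Fin; zero; suc; fromℕ<) renaming (_≟_ to _≟ᶠ_)
open import Data.Fin.Properties using (all?)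
open import Data.List using (List; []; _∷_; _++_; length; map; filterᵇ; concatMap; allFin) renaming (lookup to lookupᴸ; tabulate to tabulateᴸ)
open import Data.List.Membership.Propositional using (_∈_; find)
open import Data.List.Membership.Propositional.Properties using (∈-++⁺ˡ; ∈-++⁺ʳ; ∈-++⁻; ∈-map⁺; ∈-map⁻; ∈-concatMap⁺; ∈-lookup; ∈-allFin; ∈-length)
open import Data.List.Properties using (length-++; length-map; length-tabulate; map-cong)
open import Data.List.Relation.Unary.All as All using (All; []; _∷_)
import Data.List.Relation.Unary.All.Properties as All
open import Data.List.Relation.Unary.AllPairs as AllPairs using (AllPairs; []; _∷_)
import Data.List.Relation.Unary.AllPairs.Properties as AllPairs
open import Data.List.Relation.Unary.Any as Any using (Any; here; there)
import Data.List.Relation.Unary.Any.Properties as Any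
open import Data.List.Relation.Unary.Unique.Propositional using (Unique)
import Data.List.Relation.Unary.Unique.Propositional.Properties as Unique
open import Data.Maybe using (Maybe; just; nothing; is-just)
import Data.Maybe.Properties as Maybe
open import Data.Nat using (ℕ; zero; suc; _+_; _*_; _∸_; _^_; _≤_; _<_; _≤ᵇ_; _≤?_; _≡ᵇ_; z≤n; s≤s; NonZero; >-nonZero)
open import Data.Nat.DivMod using (_/_; m/n*n≤m; m≡m%n+[m/n]*n; m%n<n)
open import Data.Nat.Properties
open import Data.Nat.Tactic.RingSolver using (solve-∀)
open import Data.Product using (Σ; ∃-syntax; _×_; _,_; proj₁; proj₂)
open import Data.Sum using (_⊎_; inj₁; inj₂)
open import Data.Vec using (Vec; []; _∷_; head; tail; replicate; lookup; tabulate)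
open import Data.Vec.Properties using (≡-dec; lookup∘tabulate; tabulate-cong)
open import Data.Vec.Relation.Unary.All using ([]; _∷_) renaming (All to VAll; all? to allᵛ?)
open import Data.Vec.Relation.Unary.All.Properties using (lookup⁺) renaming (tabulate⁺ to tabulateᵛ)
open import Function using (_∘_; id; Equivalence)
open import Relation.Binary using (DecidableEquality)
open import Relation.Binary.PropositionalEquality using (_≡_; _≢_; refl; sym; trans; cong; cong₂; subst)
open import Relation.Nullary using (¬_; yes; no; ⌊_⌋; contradiction; Dec)
open import Relation.Nullary.Decidable using (_→-dec_; toWitness; fromWitness)

-- Finite sums and counting

-- At level `i` a hypergraph is saturated once it has about `D * N / t ^ (i + 1)` edges, that is,
-- typical degree about `D / t ^ (i + 1)`. A useful head adds about that many tails, while the next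
-- level asks for only `D * N / t ^ (i + 2)` of them, so about `N / t` hits suffice and a larger `t`
-- means fewer known clauses. The price lies in the caps: measured against `t` times the typical
-- degree, `j` prescribed clauses must save a factor `t ^ (j - 1)`, with `j` up to the number of
-- clauses of the formula, whereas the only saving guaranteed is one factor `n`. This balance gives
-- the exponent `1 / (m - 1)`. Edges are counted with multiplicity, since one tail may be linked
-- through several heads.

T⇒≡ : ∀ {b} → T b → b ≡ true
T⇒≡ = Equivalence.to T-≡

≡⇒T : ∀ {b} → b ≡ true → T b
≡⇒T = Equivalence.from T-≡

∧-split : ∀ {a b} → a ∧ b ≡ true → a ≡ true × b ≡ true
∧-split {true} {true} _ = refl , refl

∧-join : ∀ {a b} → a ≡ true → b ≡ true → a ∧ b ≡ true
∧-join refl refl = refl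

private
  variable
    A B : Set

𝟙 : Bool → ℕ
𝟙 true  = 1
𝟙 false = 0

∑ : List A → (A → ℕ) → ℕ
∑ []       f = 0
∑ (x ∷ xs) f = f x + ∑ xs f

count : (A → Bool) → List A → ℕ
count p xs = ∑ xs (λ x → 𝟙 (p x))

∑-mono : ∀ (xs : List A) {f g} → (∀ x → x ∈ xs → f x ≤ g x) → ∑ xs f ≤ ∑ xs g
∑-mono []       h = z≤n
∑-mono (x ∷ xs) h = +-mono-≤ (h x (here refl)) (∑-mono xs (λ y y∈ → h y (there y∈)))

∑-zero : ∀ (xs : List A) → ∑ xs (λ _ → 0) ≡ 0
∑-zero []       = refl
∑-zero (x ∷ xs) = ∑-zero xs

∑-+ : ∀ (xs : List A) f g → ∑ xs (λ x → f x + g x) ≡ ∑ xs f + ∑ xs g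
∑-+ []       f g = refl
∑-+ (x ∷ xs) f g rewrite ∑-+ xs f g = interchange +-commutativeSemigroup (f x) (g x) (∑ xs f) (∑ xs g)

∑-* : ∀ (xs : List A) c f → ∑ xs (λ x → c * f x) ≡ c * ∑ xs f
∑-* []       c f = sym (*-zeroʳ c)
∑-* (x ∷ xs) c f rewrite ∑-* xs c f = sym (*-distribˡ-+ c (f x) (∑ xs f))

∑-const : ∀ (xs : List A) c → ∑ xs (λ _ → c) ≡ length xs * c
∑-const []       c = refl
∑-const (x ∷ xs) c = cong (c +_) (∑-const xs c)

∑-swap : ∀ (xs : List A) (ys : List B) (f : A → B → ℕ) →
  ∑ xs (λ x → ∑ ys (f x)) ≡ ∑ ys (λ y → ∑ xs (λ x → f x y))
∑-swap []       ys f = sym (∑-zero ys)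
∑-swap (x ∷ xs) ys f rewrite ∑-swap xs ys f = sym (∑-+ ys (f x) (λ y → ∑ xs (λ z → f z y)))

∑-++ : ∀ (xs ys : List A) f → ∑ (xs ++ ys) f ≡ ∑ xs f + ∑ ys f
∑-++ []       ys f = refl
∑-++ (x ∷ xs) ys f rewrite ∑-++ xs ys f = sym (+-assoc (f x) _ _)

∑-map : ∀ (xs : List A) (h : A → B) f → ∑ (map h xs) f ≡ ∑ xs (λ x → f (h x))
∑-map []       h f = refl
∑-map (x ∷ xs) h f = cong (f (h x) +_) (∑-map xs h f)

∑-≤-const : ∀ (xs : List A) {f} c → (∀ x → x ∈ xs → f x ≤ c) → ∑ xs f ≤ length xs * c
∑-≤-const xs c h = ≤-trans (∑-mono xs h) (≤-reflexive (∑-const xs c))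

∑-elem : ∀ (f : A → ℕ) {xs x} → x ∈ xs → f x ≤ ∑ xs f
∑-elem f (here refl) = m≤m+n _ _
∑-elem f (there x∈)  = ≤-trans (∑-elem f x∈) (m≤n+m _ _)

𝟙-mono : ∀ {a b} → (a ≡ true → b ≡ true) → 𝟙 a ≤ 𝟙 b
𝟙-mono {false} h = z≤n
𝟙-mono {true}  h rewrite h refl = ≤-refl

𝟙≤1 : ∀ b → 𝟙 b ≤ 1
𝟙≤1 true  = ≤-refl
𝟙≤1 false = z≤n

count-mono : ∀ {p q : A → Bool} (xs : List A) → (∀ x → x ∈ xs → p x ≡ true → q x ≡ true) →
  count p xs ≤ count q xs
count-mono xs h = ∑-mono xs (λ x x∈ → 𝟙-mono (h x x∈))

count≤length : ∀ (p : A → Bool) xs → count p xs ≤ length xs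
count≤length p xs = subst (count p xs ≤_) (*-identityʳ _) (∑-≤-const xs 1 (λ x _ → 𝟙≤1 (p x)))

count-not : ∀ (p : A → Bool) xs → count p xs + count (not ∘ p) xs ≡ length xs
count-not p xs = trans (sym (∑-+ xs _ _)) (sum≡ xs)
  where
  sum≡ : ∀ xs → ∑ xs (λ x → 𝟙 (p x) + 𝟙 (not (p x))) ≡ length xs
  sum≡ []       = refl
  sum≡ (x ∷ xs) with p x
  ... | true  = cong suc (sum≡ xs)
  ... | false = cong suc (sum≡ xs)

count-zero : ∀ (p : A → Bool) xs → (∀ x → x ∈ xs → p x ≢ true) → count p xs ≡ 0
count-zero p []       h = refl
count-zero p (x ∷ xs) h with p x in eq
... | true  = ⊥-elim (h x (here refl) eq)
... | false = count-zero p xs (λ y y∈ → h y (there y∈))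

count-zero⊎witness : ∀ (p : A → Bool) xs → count p xs ≡ 0 ⊎ ∃[ x ] (x ∈ xs × p x ≡ true)
count-zero⊎witness p []       = inj₁ refl
count-zero⊎witness p (x ∷ xs) with p x in eq
... | true  = inj₂ (x , here refl , eq)
... | false with count-zero⊎witness p xs
...   | inj₁ z             = inj₁ z
...   | inj₂ (y , y∈ , py) = inj₂ (y , there y∈ , py)

length-filterᵇ : ∀ (p : A → Bool) xs → length (filterᵇ p xs) ≡ count p xs
length-filterᵇ p []       = refl
length-filterᵇ p (x ∷ xs) with p x
... | true  = cong suc (length-filterᵇ p xs)
... | false = length-filterᵇ p xs

∈-filterᵇ⁺ : ∀ (p : A → Bool) {x xs} → x ∈ xs → p x ≡ true → x ∈ filterᵇ p xs
∈-filterᵇ⁺ p {xs = y ∷ xs} (here refl) px rewrite px = here refl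
∈-filterᵇ⁺ p {xs = y ∷ xs} (there x∈) px with p y
... | true  = there (∈-filterᵇ⁺ p x∈ px)
... | false = ∈-filterᵇ⁺ p x∈ px

∈-filterᵇ⁻ : ∀ (p : A → Bool) {x xs} → x ∈ filterᵇ p xs → x ∈ xs × p x ≡ true
∈-filterᵇ⁻ p {xs = y ∷ xs} x∈ with p y in eq
∈-filterᵇ⁻ p {xs = y ∷ xs} (here refl) | true = here refl , eq
∈-filterᵇ⁻ p {xs = y ∷ xs} (there x∈)  | true with ∈-filterᵇ⁻ p x∈
... | x∈′ , px = there x∈′ , px
∈-filterᵇ⁻ p {xs = y ∷ xs} x∈ | false with ∈-filterᵇ⁻ p x∈
... | x∈′ , px = there x∈′ , px

count-filterᵇ : ∀ (p q : A → Bool) xs → count q (filterᵇ p xs) ≡ count (λ x → p x ∧ q x) xs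
count-filterᵇ p q []       = refl
count-filterᵇ p q (x ∷ xs) with p x
... | true  = cong (𝟙 (q x) +_) (count-filterᵇ p q xs)
... | false = count-filterᵇ p q xs

any⁺ : ∀ (p : A → Bool) {x xs} → x ∈ xs → p x ≡ true → any p xs ≡ true
any⁺ p (here refl) px rewrite px = refl
any⁺ p {xs = y ∷ xs} (there x∈) px with p y
... | true  = refl
... | false = any⁺ p x∈ px

any⁻ : ∀ (p : A → Bool) xs → any p xs ≡ true → ∃[ x ] (x ∈ xs × p x ≡ true)
any⁻ p (x ∷ xs) h with p x in eq
... | true  = x , here refl , eq
... | false with any⁻ p xs h
...   | y , y∈ , py = y , there y∈ , py

𝟙-any : ∀ (p : A → Bool) xs → 𝟙 (any p xs) ≤ count p xs
𝟙-any p []       = z≤n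
𝟙-any p (x ∷ xs) with p x
... | true  = s≤s z≤n
... | false = 𝟙-any p xs

-- Fingerprint trees

-- `P` is what is known about `F` at a node of the decision tree, and `c` bounds the number of
-- leaves below it. The tree is never built: covers are combined directly.
CoveredBy : ∀ {X : Set} → (List X → Set) → ℕ → ((X → Bool) → Set) → Set
CoveredBy {X} Good c P = ∃[ 𝓒 ] (length {A = List X} 𝓒 ≤ c × All Good 𝓒 ×
  (∀ F → P F → Any (λ C → ∀ x → F x ≡ true → x ∈ C) 𝓒))

Avoids : ∀ {X : Set} → (X → Bool) → List X → (X → Bool) → Set
Avoids u L F = ∀ x → x ∈ L → u x ≡ true → F x ≡ false

module _ {X : Set} {Good : List X → Set} where

  covered-mono : ∀ {c d} {P Q : (X → Bool) → Set} → c ≤ d → (∀ F → P F → Q F) →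
    CoveredBy Good c Q → CoveredBy Good d P
  covered-mono c≤d P⊆Q (𝓒 , len , good , cov) = 𝓒 , ≤-trans len c≤d , good , λ F PF → cov F (P⊆Q F PF)

  covered-empty : ∀ {c} {P : (X → Bool) → Set} → (∀ F → ¬ P F) → CoveredBy Good c P
  covered-empty ¬P = [] , z≤n , [] , λ F PF → ⊥-elim (¬P F PF)

  covered-∪ : ∀ {c d} {P Q R : (X → Bool) → Set} → (∀ F → R F → P F ⊎ Q F) →
    CoveredBy Good c P → CoveredBy Good d Q → CoveredBy Good (c + d) R
  covered-∪ {R = R} split (𝓒 , len , good , cov) (𝓓 , len′ , good′ , cov′) =
    𝓒 ++ 𝓓 , ≤-trans (≤-reflexive (length-++ 𝓒)) (+-mono-≤ len len′) , All.++⁺ good good′ , cover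
    where
    cover : ∀ F → R F → Any (λ C → ∀ x → F x ≡ true → x ∈ C) (𝓒 ++ 𝓓)
    cover F RF with split F RF
    ... | inj₁ PF = Any.++⁺ˡ (cov F PF)
    ... | inj₂ QF = Any.++⁺ʳ 𝓒 (cov′ F QF)

  -- The question asked is which vertex of `L` satisfying `u` is the first to lie in `F`: one child
  -- for each possible answer and one for none. Vertices outside `u` are paid for too, which keeps
  -- the factor independent of `u`.
  branch : ∀ {c} {P : (X → Bool) → Set} (u : X → Bool) L →
    (∀ x → x ∈ L → u x ≡ true → CoveredBy Good c (λ F → P F × F x ≡ true)) →
    CoveredBy Good c (λ F → P F × Avoids u L F) →
    CoveredBy Good (suc (length L) * c) P
  branch {c} u [] hit miss = covered-mono (≤-reflexive (sym (*-identityˡ c))) (λ F PF → PF , λ x ()) miss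
  branch {c} {P} u (x ∷ L) hit miss with u x in ux
  ... | false = covered-mono (m≤n+m _ c) (λ F PF → PF)
        (branch u L (λ y y∈ → hit y (there y∈)) (covered-mono ≤-refl extend miss))
    where
    extend : ∀ F → P F × Avoids u L F → P F × Avoids u (x ∷ L) F
    extend F (PF , av) = PF , λ where
      y (here refl) uy → contradiction (trans (sym ux) uy) (λ ())
      y (there y∈) uy  → av y y∈ uy
  ... | true = covered-∪ split (hit x (here refl) ux)
        (branch u L (λ y y∈ uy → covered-mono ≤-refl (λ F → λ ((PF , _) , Fy) → PF , Fy) (hit y (there y∈) uy))
                    (covered-mono ≤-refl extend miss))
    where
    split : ∀ F → P F → (P F × F x ≡ true) ⊎ (P F × F x ≡ false)
    split F PF with F x
    ... | true  = inj₁ (PF , refl)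
    ... | false = inj₂ (PF , refl)
    extend : ∀ F → (P F × F x ≡ false) × Avoids u L F → P F × Avoids u (x ∷ L) F
    extend F ((PF , Fx) , av) = PF , λ where
      y (here refl) uy → Fx
      y (there y∈) uy  → av y y∈ uy

-- Shrinking a dense hypergraph

card : ∀ {X : Set} {s} → Vec (Maybe X) s → ℕ
card []            = 0
card (nothing ∷ π) = card π
card (just _ ∷ π)  = suc (card π)

weight : ∀ {s} → Vec Bool s → ℕ
weight []          = 0
weight (false ∷ J) = weight J
weight (true ∷ J)  = suc (weight J)

restrict : ∀ {X : Set} {s} → Vec Bool s → Vec X s → Vec (Maybe X) s
restrict []          []      = []
restrict (true ∷ J)  (x ∷ y) = just x ∷ restrict J y
restrict (false ∷ J) (x ∷ y) = nothing ∷ restrict J y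

card-restrict : ∀ {X : Set} {s} (J : Vec Bool s) (y : Vec X s) → card (restrict J y) ≡ weight J
card-restrict []          []      = refl
card-restrict (true ∷ J)  (x ∷ y) = cong suc (card-restrict J y)
card-restrict (false ∷ J) (x ∷ y) = card-restrict J y

masks : ∀ s → List (Vec Bool s)
masks zero    = [] ∷ []
masks (suc s) = map (true ∷_) (masks s) ++ map (false ∷_) (masks s)

length-masks : ∀ s → length (masks s) ≡ 2 ^ s
length-masks zero    = refl
length-masks (suc s) = trans (length-++ (map (true ∷_) (masks s))) (cong₂ _+_
  (trans (length-map _ (masks s)) (length-masks s))
  (trans (length-map _ (masks s)) (trans (length-masks s) (sym (+-identityʳ _)))))

masks-complete : ∀ {s} (J : Vec Bool s) → J ∈ masks s
masks-complete []          = here refl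
masks-complete (true ∷ J)  = ∈-++⁺ˡ (∈-map⁺ (true ∷_) (masks-complete J))
masks-complete (false ∷ J) = ∈-++⁺ʳ _ (∈-map⁺ (false ∷_) (masks-complete J))

Independent : ∀ {X : Set} {s} → List (Vec X s) → (X → Bool) → Set
Independent H F = ∀ e → e ∈ H → ¬ VAll (λ x → F x ≡ true) e

-- The way out of the current round: `F` avoids at least `N / A` vertices of `G`, and what remains
-- is handled within `c` leaves.
Continuation : ∀ {X : Set} → (List X → Set) → ((X → Bool) → Set) → List X → ℕ → ℕ → ℕ → Set
Continuation Good P G N A c =
  ∀ u → N ≤ A * count u G → CoveredBy Good c (λ F → P F × Avoids u G F)

module Patterns {X : Set} (_≟_ : DecidableEquality X) where

  matches : ∀ {s} → Vec (Maybe X) s → Vec X s → Bool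
  matches []            []      = true
  matches (nothing ∷ π) (x ∷ e) = matches π e
  matches (just y ∷ π)  (x ∷ e) = ⌊ y ≟ x ⌋ ∧ matches π e

  ≟-refl : ∀ x → ⌊ x ≟ x ⌋ ≡ true
  ≟-refl x with x ≟ x
  ... | yes _  = refl
  ... | no x≢x = contradiction refl x≢x

  ≟-true : ∀ x y → ⌊ x ≟ y ⌋ ≡ true → x ≡ y
  ≟-true x y h with x ≟ y
  ... | yes eq = eq

  ≟-sym : ∀ x y → ⌊ x ≟ y ⌋ ≡ ⌊ y ≟ x ⌋
  ≟-sym x y with x ≟ y | y ≟ x
  ... | yes _  | yes _  = refl
  ... | no _   | no _   = refl
  ... | yes eq | no neq = contradiction (sym eq) neq
  ... | no neq | yes eq = contradiction (sym eq) neq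

  matches-sym : ∀ {s} (J : Vec Bool s) (y z : Vec X s) →
    matches (restrict J y) z ≡ matches (restrict J z) y
  matches-sym []          []      []      = refl
  matches-sym (true ∷ J)  (y ∷ v) (z ∷ w) = cong₂ _∧_ (≟-sym y z) (matches-sym J v w)
  matches-sym (false ∷ J) (y ∷ v) (z ∷ w) = matches-sym J v w

  -- Every prescribed entry repeats that of `y`, so only `2 ^ s` patterns contain `y`, one for each
  -- mask. Testing these is enough to detect a heavy pattern.
  matches⇒restrict : ∀ {s} (π : Vec (Maybe X) s) y → matches π y ≡ true → ∃[ J ] (π ≡ restrict J y)
  matches⇒restrict []            []      h = [] , refl
  matches⇒restrict (nothing ∷ π) (x ∷ y) h with matches⇒restrict π y h
  ... | J , refl = false ∷ J , refl
  matches⇒restrict (just z ∷ π)  (x ∷ y) h with ≟-true z x (proj₁ (∧-split h)) | matches⇒restrict π y (proj₂ (∧-split h))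
  ... | refl | J , refl = true ∷ J , refl

  matches-blank : ∀ {s} (e : Vec X s) → matches (replicate s nothing) e ≡ true
  matches-blank []      = refl
  matches-blank (x ∷ e) = matches-blank e

card-blank : ∀ {X : Set} s → card {X} (replicate s nothing) ≡ 0
card-blank zero    = refl
card-blank (suc s) = card-blank s

-- Chosen so that, as long as H′ is not saturated, at most half of the edges of H are blocked.
nextγ : ℕ → ℕ → ℕ → ℕ
nextγ s K γ = 2 * γ * (2 ^ s * K)

-- Hits along a branch, in units of `x`, which is about `N / t`: growing one level uses `4 * γ * Q`,
-- and the shorter tuples continue with the constants of the next level.
depth : ℕ → ℕ → ℕ → ℕ → ℕ
depth Q zero    K γ = 0
depth Q (suc s) K γ = depth Q s (suc K) (nextγ s K γ) + 4 * γ * Q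

-- Each level has its own constant `4 * γ * K` in `useful-many`; the sum dominates them all, so that
-- a single `A` serves every level.
loss : ℕ → ℕ → ℕ → ℕ
loss zero    K γ = 0
loss (suc s) K γ = 4 * γ * K + loss s (suc K) (nextγ s K γ)

pos-* : ∀ {a b} → 1 ≤ a → 1 ≤ b → 1 ≤ a * b
pos-* p q = *-mono-≤ p q

pos-^ : ∀ {a} → 1 ≤ a → ∀ b → 1 ≤ a ^ b
pos-^ p b = m^n>0 _ {{>-nonZero p}} b

cancel-* : ∀ {a b c} → 1 ≤ c → c * a ≤ c * b → a ≤ b
cancel-* {a} {b} {c} p = *-cancelˡ-≤ {a} {b} c {{>-nonZero p}}

module Shrinking {X : Set} (_≟_ : DecidableEquality X)
  (t D N Q : ℕ) (1≤t : 1 ≤ t) (1≤D : 1 ≤ D) (1≤N : 1 ≤ N) (1≤Q : 1 ≤ Q) where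

  open Patterns _≟_

  -- D is t times the typical degree in the initial hypergraph and N is the number of vertices up to a
  -- constant; i counts the links taken so far.  Each link, and each further prescribed coordinate,
  -- costs a factor t.
  Capped : ∀ {s} → ℕ → ℕ → List (Vec X s) → Set
  Capped i K H = ∀ π → 1 ≤ card π → t ^ (i + card π) * count (matches π) H ≤ K * D

  Saturated : ∀ {s} → ℕ → ℕ → List (Vec X s) → Set
  Saturated i γ H = D * N ≤ γ * (t ^ suc i * length H)

  -- A single level: heavy patterns, blocked tails, useful heads

  module _ {s} (i : ℕ) (H′ : List (Vec X s)) where

    -- The threshold is `D` although the cap on `H′` is `suc K * D`: the gap `K * D` is the most
    -- that one link can add to a pattern, so crossing the threshold never breaks the cap.
    heavy : Vec (Maybe X) s → Bool
    heavy π = (1 ≤ᵇ card π) ∧ (D ≤ᵇ t ^ (suc i + card π) * count (matches π) H′)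

    blocked : Vec X s → Bool
    blocked y = any (λ J → heavy (restrict J y)) (masks s)

    -- Double counting of the pairs of `e` in `H` and `y` in `H′` that agree on `J`: a heavy pattern
    -- puts at least `D / U` pairs at `e`, and the cap on `H` limits those at `y`. In `H` the head
    -- stays free, so the cap offers `t ^ (i + weight J)` against `t ^ (suc i + weight J)`; hence
    -- the factor `t`.
    heavy-count : ∀ {K} (H : List (Vec X (suc s))) → Capped i K H → ∀ J →
      count (λ e → heavy (restrict J (tail e))) H ≤ t * K * length H′
    heavy-count {K} H cap J with 1 ≤? weight J
    ... | no w = ≤-trans (≤-reflexive (count-zero _ H λ e _ h → w
            (subst (1 ≤_) (card-restrict J (tail e)) (≤ᵇ⇒≤ 1 _ (≡⇒T (proj₁ (∧-split h))))))) z≤n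
    ... | yes 1≤w = cancel-* 1≤D (begin
        D * count (λ e → heavy (restrict J (tail e))) H                ≡⟨ ∑-* H D _ ⟨
        ∑ H (λ e → D * 𝟙 (heavy (restrict J (tail e))))                ≤⟨ ∑-mono H (λ e _ → pointwise e) ⟩
        ∑ H (λ e → U * count (matches (restrict J (tail e))) H′)       ≡⟨ ∑-* H U _ ⟩
        U * ∑ H (λ e → count (matches (restrict J (tail e))) H′)       ≡⟨ cong (U *_) (∑-swap H H′ _) ⟩
        U * ∑ H′ (λ y → ∑ H (λ e → 𝟙 (matches (restrict J (tail e)) y))) ≡⟨ ∑-* H′ U _ ⟨
        ∑ H′ (λ y → U * ∑ H (λ e → 𝟙 (matches (restrict J (tail e)) y))) ≤⟨ ∑-≤-const H′ (t * (K * D)) (λ y _ → degree y) ⟩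
        length H′ * (t * (K * D))                                      ≡⟨ shuffle (length H′) t K D ⟩
        D * (t * K * length H′)                                        ∎)
      where
      open ≤-Reasoning
      U = t ^ (suc i + weight J)
      shuffle : ∀ h t K D → h * (t * (K * D)) ≡ D * (t * K * h)
      shuffle = solve-∀
      pointwise : ∀ e → D * 𝟙 (heavy (restrict J (tail e))) ≤ U * count (matches (restrict J (tail e))) H′
      pointwise e with heavy (restrict J (tail e)) in eq
      ... | false = ≤-trans (≤-reflexive (*-zeroʳ D)) z≤n
      ... | true  = ≤-trans (≤-reflexive (*-identityʳ D))
            (subst (λ w → D ≤ t ^ (suc i + w) * count (matches (restrict J (tail e))) H′)
              (card-restrict J (tail e)) (≤ᵇ⇒≤ D _ (≡⇒T (proj₂ (∧-split {1 ≤ᵇ card (restrict J (tail e))} eq)))))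
      degree : ∀ y → U * ∑ H (λ e → 𝟙 (matches (restrict J (tail e)) y)) ≤ t * (K * D)
      degree y = begin
        U * ∑ H (λ e → 𝟙 (matches (restrict J (tail e)) y))  ≤⟨ *-monoʳ-≤ U (∑-mono H λ { (x ∷ e) _ → ≤-reflexive (cong 𝟙 (matches-sym J e y)) }) ⟩
        U * count (matches (nothing ∷ restrict J y)) H       ≡⟨ *-assoc t _ _ ⟩
        t * (t ^ (i + weight J) * count (matches (nothing ∷ restrict J y)) H)
          ≤⟨ *-monoʳ-≤ t (subst (λ w → t ^ (i + w) * count (matches (nothing ∷ restrict J y)) H ≤ K * D)
               (card-restrict J y) (cap (nothing ∷ restrict J y) (subst (1 ≤_) (sym (card-restrict J y)) 1≤w))) ⟩
        t * (K * D) ∎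

    blocked-count : ∀ {K} (H : List (Vec X (suc s))) → Capped i K H →
      count (λ e → blocked (tail e)) H ≤ 2 ^ s * (t * K * length H′)
    blocked-count {K} H cap = begin
      count (λ e → blocked (tail e)) H                                ≤⟨ ∑-mono H (λ e _ → 𝟙-any _ (masks s)) ⟩
      ∑ H (λ e → count (λ J → heavy (restrict J (tail e))) (masks s)) ≡⟨ ∑-swap H (masks s) _ ⟩
      ∑ (masks s) (λ J → count (λ e → heavy (restrict J (tail e))) H) ≤⟨ ∑-≤-const (masks s) _ (λ J _ → heavy-count H cap J) ⟩
      length (masks s) * (t * K * length H′)                          ≡⟨ cong (_* (t * K * length H′)) (length-masks s) ⟩
      2 ^ s * (t * K * length H′)                                     ∎
      where open ≤-Reasoning

    extends : X → Vec X (suc s) → Bool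
    extends v e = ⌊ v ≟ head e ⌋ ∧ not (blocked (tail e))

    links : X → List (Vec X (suc s)) → List (Vec X s)
    links v H = map tail (filterᵇ (extends v) H)

    -- `D / t ^ suc i` is the typical degree at level `i`; a useful head keeps at least a fraction
    -- `1 / η` of it after blocked tails are discarded.
    useful : ℕ → List (Vec X (suc s)) → X → Bool
    useful η H v = D ≤ᵇ η * (t ^ suc i * count (extends v) H)

    extends-degree : ∀ {K} H → Capped i K H → ∀ v → t ^ suc i * count (extends v) H ≤ K * D
    extends-degree {K} H cap v = ≤-trans
      (*-monoʳ-≤ (t ^ suc i) (count-mono H λ { (x ∷ e) _ h → ∧-join (proj₁ (∧-split h)) (matches-blank e) }))
      (subst (λ j → t ^ j * count (matches (just v ∷ replicate s nothing)) H ≤ K * D)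
        (trans (cong (λ c → i + suc c) (card-blank s)) (+-comm i 1))
        (cap (just v ∷ replicate s nothing) (s≤s z≤n)))

    -- Averaging over heads. At least `D * N / (2 * γ * U)` edges are unblocked. The heads that are
    -- not useful, at most `Q * N` of them, carry less than `D / (η * U)` each, and `η = 4 * γ * Q`
    -- makes this at most half of that amount. The rest sits on useful heads, which carry at most
    -- `K * D / U` each.
    useful-many : ∀ {K γ} H G → 1 ≤ K → 1 ≤ γ → Capped i K H → Saturated i γ H →
      ¬ Saturated (suc i) (nextγ s K γ) H′ → (∀ e → e ∈ H → head e ∈ G) → length G ≤ Q * N →
      N ≤ 4 * γ * K * count (useful (4 * γ * Q) H) G
    useful-many {K} {γ} H G 1≤K 1≤γ cap sat ¬sat heads G≤QN = cancel-* (pos-* 1≤Q 1≤D) final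
      where
      open ≤-Reasoning
      U = t ^ suc i
      η = 4 * γ * Q
      b = count (λ e → blocked (tail e)) H
      o = count (λ e → not (blocked (tail e))) H
      u = count (useful η H) G

      few-blocked : 2 * γ * (U * b) ≤ D * N
      few-blocked = begin
        2 * γ * (U * b)                                ≤⟨ *-monoʳ-≤ (2 * γ) (*-monoʳ-≤ U (blocked-count H cap)) ⟩
        2 * γ * (U * (2 ^ s * (t * K * length H′)))    ≡⟨ shuffle γ U (2 ^ s) t K (length H′) ⟩
        nextγ s K γ * (t ^ suc (suc i) * length H′)    ≤⟨ <⇒≤ (≰⇒> ¬sat) ⟩
        D * N                                          ∎
        where
        shuffle : ∀ γ U p t K h → 2 * γ * (U * (p * (t * K * h))) ≡ 2 * γ * (p * K) * (t * U * h)
        shuffle = solve-∀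

      many-unblocked : D * N ≤ 2 * γ * (U * o)
      many-unblocked = +-cancelˡ-≤ (D * N) _ _ (begin
        D * N + D * N                       ≤⟨ +-mono-≤ sat sat ⟩
        γ * (U * length H) + γ * (U * length H) ≡⟨ cong (λ h → γ * (U * h) + γ * (U * h)) (sym (count-not _ H)) ⟩
        γ * (U * (b + o)) + γ * (U * (b + o)) ≡⟨ shuffle γ U b o ⟩
        2 * γ * (U * b) + 2 * γ * (U * o)   ≤⟨ +-monoˡ-≤ _ few-blocked ⟩
        D * N + 2 * γ * (U * o)             ∎)
        where
        shuffle : ∀ γ U b o → γ * (U * (b + o)) + γ * (U * (b + o)) ≡ 2 * γ * (U * b) + 2 * γ * (U * o)
        shuffle = solve-∀

      by-head : o ≤ ∑ G (λ v → count (extends v) H)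
      by-head = ≤-trans (∑-mono H λ e e∈ → ≤-trans
          (𝟙-mono (λ h → ∧-join (≟-refl (head e)) h))
          (∑-elem (λ v → 𝟙 (extends v e)) (heads e e∈)))
        (≤-reflexive (∑-swap H G _))

      degree-split : ∀ v → η * (U * count (extends v) H) ≤ η * (K * D) * 𝟙 (useful η H v) + D
      degree-split v with useful η H v in eq
      ... | true  = ≤-trans (*-monoʳ-≤ η (extends-degree {K} H cap v))
              (≤-trans (≤-reflexive (sym (*-identityʳ _))) (m≤m+n _ D))
      ... | false = ≤-trans (<⇒≤ (≰⇒> λ le → contradiction (trans (sym eq) (T⇒≡ (≤⇒≤ᵇ le))) λ ()))
              (m≤n+m D _)

      head-sum : η * (U * o) ≤ η * (K * D) * u + Q * N * D
      head-sum = begin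
        η * (U * o)                                              ≤⟨ *-monoʳ-≤ η (*-monoʳ-≤ U by-head) ⟩
        η * (U * ∑ G (λ v → count (extends v) H))                ≡⟨ cong (η *_) (∑-* G U _) ⟨
        η * ∑ G (λ v → U * count (extends v) H)                  ≡⟨ ∑-* G η _ ⟨
        ∑ G (λ v → η * (U * count (extends v) H))                ≤⟨ ∑-mono G (λ v _ → degree-split v) ⟩
        ∑ G (λ v → η * (K * D) * 𝟙 (useful η H v) + D)           ≡⟨ ∑-+ G _ _ ⟩
        ∑ G (λ v → η * (K * D) * 𝟙 (useful η H v)) + ∑ G (λ _ → D) ≡⟨ cong₂ _+_ (∑-* G (η * (K * D)) _) (∑-const G D) ⟩
        η * (K * D) * u + length G * D                           ≤⟨ +-monoʳ-≤ (η * (K * D) * u) (*-monoˡ-≤ D G≤QN) ⟩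
        η * (K * D) * u + Q * N * D                              ∎

      final : Q * D * N ≤ Q * D * (4 * γ * K * u)
      final = +-cancelʳ-≤ (Q * N * D) _ _ (begin
        Q * D * N + Q * N * D              ≡⟨ shuffle₁ Q D N ⟩
        2 * Q * (D * N)                    ≤⟨ *-monoʳ-≤ (2 * Q) many-unblocked ⟩
        2 * Q * (2 * γ * (U * o))          ≡⟨ shuffle₂ Q γ (U * o) ⟩
        η * (U * o)                        ≤⟨ head-sum ⟩
        η * (K * D) * u + Q * N * D        ≡⟨ cong (_+ Q * N * D) (shuffle₃ γ Q K D u) ⟩
        Q * D * (4 * γ * K * u) + Q * N * D ∎)
        where
        shuffle₁ : ∀ Q D N → Q * D * N + Q * N * D ≡ 2 * Q * (D * N)
        shuffle₁ = solve-∀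
        shuffle₂ : ∀ Q γ y → 2 * Q * (2 * γ * y) ≡ 4 * γ * Q * y
        shuffle₂ = solve-∀
        shuffle₃ : ∀ γ Q K D u → 4 * γ * Q * (K * D) * u ≡ Q * D * (4 * γ * K * u)
        shuffle₃ = solve-∀

    ∈-links : ∀ {v H y} → y ∈ links v H → (v ∷ y) ∈ H × blocked y ≡ false
    ∈-links {v} {H} y∈ with ∈-map⁻ tail y∈
    ... | (x ∷ y) , e∈ , refl with ∈-filterᵇ⁻ (extends v) {xs = H} e∈
    ...   | e∈H , h with ≟-true v x (proj₁ (∧-split h)) | blocked y | proj₂ (∧-split {⌊ v ≟ x ⌋} h)
    ...     | refl | false | _ = e∈H , refl

    -- A pattern that is already heavy occurs in no unblocked tail, so its degree no longer grows;
    -- the degree of any other pattern is below the cap and grows by at most one degree of H.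
    links-capped : ∀ {K} H v → Capped i K H → Capped (suc i) (suc K) H′ →
      Capped (suc i) (suc K) (links v H ++ H′)
    links-capped {K} H v cap cap′ π 1≤π with D ≤? t ^ (suc i + card π) * count (matches π) H′
    ... | yes big = subst (λ c → t ^ (suc i + card π) * c ≤ suc K * D)
            (sym (trans (∑-++ (links v H) H′ _) (cong (_+ count (matches π) H′) (count-zero (matches π) _ avoid))))
            (cap′ π 1≤π)
      where
      avoid : ∀ y → y ∈ links v H → matches π y ≢ true
      avoid y y∈ m with matches⇒restrict π y m
      ... | J , refl = contradiction
              (trans (sym (proj₂ (∈-links {v} {H} y∈)))
                (any⁺ (λ J → heavy (restrict J y)) (masks-complete J) (∧-join (T⇒≡ (≤⇒≤ᵇ 1≤π)) (T⇒≡ (≤⇒≤ᵇ big)))))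
              λ ()
    ... | no small = begin
        U * count (matches π) (links v H ++ H′)                   ≡⟨ cong (U *_) (∑-++ (links v H) H′ _) ⟩
        U * (count (matches π) (links v H) + count (matches π) H′) ≡⟨ *-distribˡ-+ U _ _ ⟩
        U * count (matches π) (links v H) + U * count (matches π) H′ ≤⟨ +-mono-≤ (≤-trans (*-monoʳ-≤ U linked) (subst (λ j → t ^ j * count (matches (just v ∷ π)) H ≤ K * D) (+-suc i (card π)) (cap (just v ∷ π) (s≤s z≤n)))) (<⇒≤ (≰⇒> small)) ⟩
        K * D + D                                                 ≡⟨ +-comm (K * D) D ⟩
        suc K * D                                                 ∎
      where
      open ≤-Reasoning
      U = t ^ (suc i + card π)
      linked : count (matches π) (links v H) ≤ count (matches (just v ∷ π)) H
      linked = begin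
        count (matches π) (links v H)                          ≡⟨ ∑-map (filterᵇ (extends v) H) tail _ ⟩
        count (λ e → matches π (tail e)) (filterᵇ (extends v) H) ≡⟨ count-filterᵇ (extends v) _ H ⟩
        count (λ e → extends v e ∧ matches π (tail e)) H
          ≤⟨ count-mono H (λ { (x ∷ e) _ h → ∧-join (proj₁ (∧-split (proj₁ (∧-split h)))) (proj₂ (∧-split {extends v (x ∷ e)} h)) }) ⟩
        count (matches (just v ∷ π)) H                         ∎

  -- The decision tree that grows `H′`

  module _ {Good : List X → Set} {P₀ : (X → Bool) → Set} (G : List X)
    (x M A d₀ : ℕ) (N≤xt : N ≤ x * t) (G<M : length G < M) (G≤QN : length G ≤ Q * N)
    (cont : Continuation Good P₀ G N A (M ^ d₀)) where

    1≤M : 1 ≤ M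
    1≤M = ≤-trans (s≤s z≤n) G<M

    -- The last inequality is a potential: a hit adds at least `t * D` to
    -- `η * (t ^ suc (suc i) * length H′)`, so `d` more hits suffice, and at `d = 0` the inequality
    -- itself says that `H′` is saturated. `rec` is `shrink` for the shorter tuples, passed in so
    -- that the recursion on `d` stays apart from the one on tuple length.
    grow : ∀ {s} i K γ (H : List (Vec X (suc s))) → 1 ≤ K → 1 ≤ γ → loss (suc s) K γ ≤ A →
      Capped i K H → Saturated i γ H → (∀ e → e ∈ H → VAll (_∈ G) e) → ∀ d₁ →
      (∀ (H′ : List (Vec X s)) P → Capped (suc i) (suc K) H′ → Saturated (suc i) (nextγ s K γ) H′ →
        (∀ e → e ∈ H′ → VAll (_∈ G) e) → (∀ F → P F → P₀ F) → (∀ F → P F → Independent H′ F) →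
        CoveredBy Good (M ^ (d₀ + d₁)) P) →
      ∀ d (H′ : List (Vec X s)) P → Capped (suc i) (suc K) H′ →
      (∀ e → e ∈ H′ → VAll (_∈ G) e) → (∀ F → P F → P₀ F) →
      (∀ F → P F → Independent H F) → (∀ F → P F → Independent H′ F) →
      4 * γ * Q * (D * N) ≤ nextγ s K γ * (4 * γ * Q * (t ^ suc (suc i) * length H′) + d * (t * D)) →
      CoveredBy Good (M ^ (d₀ + d₁ + d)) P
    grow {s} i K γ H 1≤K 1≤γ loss≤A cap sat inG d₁ rec = loop
      where
      open ≤-Reasoning
      γ′ = nextγ s K γ
      η = 4 * γ * Q
      V = t ^ suc (suc i)
      1≤η : 1 ≤ η
      1≤η = pos-* (pos-* {4} (s≤s z≤n) 1≤γ) 1≤Q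

      loop : ∀ d (H′ : List (Vec X s)) P → Capped (suc i) (suc K) H′ →
        (∀ e → e ∈ H′ → VAll (_∈ G) e) → (∀ F → P F → P₀ F) →
        (∀ F → P F → Independent H F) → (∀ F → P F → Independent H′ F) →
        η * (D * N) ≤ γ′ * (η * (V * length H′) + d * (t * D)) →
        CoveredBy Good (M ^ (d₀ + d₁ + d)) P
      loop d H′ P cap′ inG′ P⇒P₀ ind ind′ fuel with D * N ≤? γ′ * (V * length H′)
      loop d H′ P cap′ inG′ P⇒P₀ ind ind′ fuel | yes sat′ =
        covered-mono (^-monoʳ-≤ M {{>-nonZero 1≤M}} (m≤m+n (d₀ + d₁) d)) (λ F PF → PF) (rec H′ P cap′ sat′ inG′ P⇒P₀ ind′)
      loop zero H′ P cap′ inG′ P⇒P₀ ind ind′ fuel | no ¬sat′ =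
        contradiction (cancel-* 1≤η (≤-trans fuel (≤-reflexive (shuffle γ′ η (V * length H′))))) ¬sat′
        where
        shuffle : ∀ g η y → g * (η * y + 0) ≡ η * (g * y)
        shuffle = solve-∀
      loop (suc d) H′ P cap′ inG′ P⇒P₀ ind ind′ fuel | no ¬sat′ =
        covered-mono total (λ F PF → PF) (branch {c = M ^ (d₀ + d₁ + d)} u G hit miss)
        where
        u = useful i H′ η H
        heads : ∀ e → e ∈ H → head e ∈ G
        heads (x ∷ e) e∈ with inG (x ∷ e) e∈
        ... | x∈ ∷ _ = x∈
        total : suc (length G) * M ^ (d₀ + d₁ + d) ≤ M ^ (d₀ + d₁ + suc d)
        total = ≤-trans (*-monoˡ-≤ (M ^ (d₀ + d₁ + d)) G<M) (≤-reflexive (cong (M ^_) (sym (+-suc (d₀ + d₁) d))))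
        -- A miss gives up `H′`: only `P₀` and the avoided vertices are passed on, and the next
        -- round starts afresh from a smaller container.
        miss : CoveredBy Good (M ^ (d₀ + d₁ + d)) (λ F → P F × Avoids u G F)
        miss = covered-mono
          (^-monoʳ-≤ M {{>-nonZero 1≤M}} (≤-trans (m≤m+n d₀ d₁) (m≤m+n (d₀ + d₁) d)))
          (λ F → λ (PF , av) → P⇒P₀ F PF , av)
          (cont u (≤-trans (useful-many i H′ H G 1≤K 1≤γ cap sat ¬sat′ heads G≤QN)
            (*-monoˡ-≤ (count u G) (≤-trans (m≤m+n (4 * γ * K) _) loss≤A))))
        hit : ∀ v → v ∈ G → u v ≡ true → CoveredBy Good (M ^ (d₀ + d₁ + d)) (λ F → P F × F v ≡ true)
        hit v v∈ uv = loop d (links i H′ v H ++ H′) (λ F → P F × F v ≡ true)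
          (links-capped i H′ {K} H v cap cap′) inG″ (λ F → λ (PF , _) → P⇒P₀ F PF) (λ F → λ (PF , _) → ind F PF) ind″ fuel″
          where
          inG″ : ∀ e → e ∈ links i H′ v H ++ H′ → VAll (_∈ G) e
          inG″ e e∈ with ∈-++⁻ (links i H′ v H) e∈
          ... | inj₂ e∈H′ = inG′ e e∈H′
          ... | inj₁ e∈links with inG (v ∷ e) (proj₁ (∈-links i H′ {v} {H} e∈links))
          ...   | _ ∷ e⊆G = e⊆G
          ind″ : ∀ F → P F × F v ≡ true → Independent (links i H′ v H ++ H′) F
          ind″ F (PF , Fv) e e∈ e⊆F with ∈-++⁻ (links i H′ v H) e∈
          ... | inj₂ e∈H′    = ind′ F PF e e∈H′ e⊆F
          ... | inj₁ e∈links = ind F PF (v ∷ e) (proj₁ (∈-links i H′ {v} {H} e∈links)) (Fv ∷ e⊆F)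
          L = length (links i H′ v H)
          -- Usefulness of `v` gives `D` at the scale `t ^ suc i` of `H`; the extra `t` passes to
          -- the scale of `H′`, one level down.
          progress : t * D ≤ η * (V * L)
          progress = begin
            t * D                                               ≤⟨ *-monoʳ-≤ t (≤ᵇ⇒≤ D _ (≡⇒T uv)) ⟩
            t * (η * (t ^ suc i * count (extends i H′ v) H))    ≡⟨ cong (λ c → t * (η * (t ^ suc i * c))) (sym (trans (length-map tail (filterᵇ (extends i H′ v) H)) (length-filterᵇ (extends i H′ v) H))) ⟩
            t * (η * (t ^ suc i * L))                           ≡⟨ shuffle t η (t ^ suc i) L ⟩
            η * (V * L)                                         ∎
            where
            shuffle : ∀ t η U L → t * (η * (U * L)) ≡ η * (t * U * L)
            shuffle = solve-∀
          fuel″ : η * (D * N) ≤ γ′ * (η * (V * length (links i H′ v H ++ H′)) + d * (t * D))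
          fuel″ = begin
            η * (D * N)                                              ≤⟨ fuel ⟩
            γ′ * (η * (V * length H′) + (t * D + d * (t * D)))       ≤⟨ *-monoʳ-≤ γ′ (+-monoʳ-≤ (η * (V * length H′)) (+-monoˡ-≤ (d * (t * D)) progress)) ⟩
            γ′ * (η * (V * length H′) + (η * (V * L) + d * (t * D))) ≡⟨ cong (γ′ *_) (shuffle η V (length H′) L (d * (t * D))) ⟩
            γ′ * (η * (V * (L + length H′)) + d * (t * D))           ≡⟨ cong (λ l → γ′ * (η * (V * l) + d * (t * D))) (sym (length-++ (links i H′ v H))) ⟩
            γ′ * (η * (V * length (links i H′ v H ++ H′)) + d * (t * D)) ∎
            where
            shuffle : ∀ η V a b r → η * (V * a) + (η * (V * b) + r) ≡ η * (V * (b + a)) + r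
            shuffle = solve-∀

    shrink : ∀ s i K γ (H : List (Vec X s)) P → 1 ≤ K → 1 ≤ γ → loss s K γ ≤ A →
      Capped i K H → Saturated i γ H → (∀ e → e ∈ H → VAll (_∈ G) e) →
      (∀ F → P F → P₀ F) → (∀ F → P F → Independent H F) →
      CoveredBy Good (M ^ (d₀ + x * depth Q s K γ)) P
    -- For tuples of length zero saturation provides an edge, and the empty edge lies in every `F`,
    -- so no independent `F` is left.
    shrink zero i K γ [] P 1≤K 1≤γ loss≤A cap sat inG P⇒P₀ ind = contradiction
      (≤-trans (pos-* 1≤D 1≤N) (≤-trans sat (≤-reflexive (trans (cong (γ *_) (*-zeroʳ (t ^ suc i))) (*-zeroʳ γ))))) λ ()
    shrink zero i K γ ([] ∷ H) P 1≤K 1≤γ loss≤A cap sat inG P⇒P₀ ind =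
      covered-empty λ F PF → ind F PF [] (here refl) []
    shrink (suc s) i K γ H P 1≤K 1≤γ loss≤A cap sat inG P⇒P₀ ind =
      covered-mono (≤-reflexive (cong (M ^_) (shuffle d₀ x (depth Q s (suc K) γ′) η))) (λ F PF → PF)
        (grow i K γ H 1≤K 1≤γ loss≤A cap sat inG (x * depth Q s (suc K) γ′)
          (λ H′ P′ cap′ sat′ inG′ P′⇒P₀ ind′ → shrink s (suc i) (suc K) γ′ H′ P′ (s≤s z≤n) 1≤γ′
            (≤-trans (m≤n+m _ (4 * γ * K)) loss≤A) cap′ sat′ inG′ P′⇒P₀ ind′)
          (x * η) [] P (λ π _ → ≤-trans (≤-reflexive (*-zeroʳ (t ^ (suc i + card π)))) z≤n) (λ _ ()) P⇒P₀ ind (λ _ _ _ ()) fuel)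
      where
      open ≤-Reasoning
      γ′ = nextγ s K γ
      η = 4 * γ * Q
      1≤γ′ : 1 ≤ γ′
      1≤γ′ = pos-* (pos-* {2} (s≤s z≤n) 1≤γ) (pos-* (pos-^ (s≤s z≤n) s) 1≤K)
      shuffle : ∀ a x p e → a + x * p + x * e ≡ a + x * (p + e)
      shuffle = solve-∀
      -- From the empty `H′`, `x * η` hits reach saturation because `N ≤ x * t`.
      fuel : η * (D * N) ≤ γ′ * (η * (t ^ suc (suc i) * 0) + x * η * (t * D))
      fuel = begin
        η * (D * N)                 ≤⟨ *-monoʳ-≤ η (*-monoʳ-≤ D N≤xt) ⟩
        η * (D * (x * t))           ≡⟨ reorder η D x t (t ^ suc (suc i)) ⟩
        1 * (η * (t ^ suc (suc i) * 0) + x * η * (t * D))  ≤⟨ *-monoˡ-≤ _ 1≤γ′ ⟩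
        γ′ * (η * (t ^ suc (suc i) * 0) + x * η * (t * D)) ∎
        where
        reorder : ∀ η D x t V → η * (D * (x * t)) ≡ 1 * (η * (V * 0) + x * η * (t * D))
        reorder = solve-∀

∑-concatMap : ∀ {A B : Set} (xs : List A) (h : A → List B) f →
  ∑ (concatMap h xs) f ≡ ∑ xs (λ x → ∑ (h x) f)
∑-concatMap []       h f = refl
∑-concatMap (x ∷ xs) h f = trans (∑-++ (h x) (concatMap h xs) f) (cong (∑ (h x) f +_) (∑-concatMap xs h f))

-- Clauses

_≟ᶜ_ : ∀ {n} → DecidableEquality (Clause n)
_≟ᶜ_ = ≡-dec (Maybe.≡-dec _≟ᵇ_)

extensions : ∀ {n} → Clause n → List (Clause (suc n))
extensions c = (nothing ∷ c) ∷ (just true ∷ c) ∷ (just false ∷ c) ∷ []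

extensions-tail : ∀ {n} {c : Clause n} {e} → e ∈ extensions c → tail e ≡ c
extensions-tail (here refl)                 = refl
extensions-tail (there (here refl))         = refl
extensions-tail (there (there (here refl))) = refl

allClauses-complete : ∀ {n} (c : Clause n) → c ∈ allClauses n
allClauses-complete []      = here refl
allClauses-complete (l ∷ c) = ∈-concatMap⁺ extensions (Any.map (λ { refl → pick l }) (allClauses-complete c))
  where
  pick : ∀ l → (l ∷ c) ∈ extensions c
  pick nothing      = here refl
  pick (just true)  = there (here refl)
  pick (just false) = there (there (here refl))

allClauses-unique : ∀ n → Unique (allClauses n)
allClauses-unique zero    = [] ∷ []
allClauses-unique (suc n) = Unique.concat⁺
  (All.map⁺ (All.universal extensions-unique (allClauses n)))
  (AllPairs.map⁺ (AllPairs.map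
    (λ c≢d {_} (e∈c , e∈d) → c≢d (trans (sym (extensions-tail e∈c)) (extensions-tail e∈d)))
    (allClauses-unique n)))
  where
  extensions-unique : ∀ c → Unique (extensions c)
  extensions-unique c = ((λ ()) ∷ (λ ()) ∷ []) ∷ ((λ ()) ∷ []) ∷ [] ∷ []

-- A new first variable is absent or carries one of two signs, so the counts obey a Pascal rule with
-- weight `2`. The factor `2 ^ k` becomes the constant `Q`.
count-width : ∀ n k → count (λ c → width c ≡ᵇ k) (allClauses n) ≤ (2 * n) ^ k
count-width zero    zero    = ≤-refl
count-width zero    (suc k) = z≤n
count-width (suc n) zero    = ≤-trans (≤-reflexive (∑-concatMap (allClauses n) extensions _))
  (≤-trans (∑-mono (allClauses n) (λ c _ → ≤-reflexive (+-identityʳ _))) (count-width n zero))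
count-width (suc n) (suc k) = begin
  count (λ c → width c ≡ᵇ suc k) (allClauses (suc n))
    ≡⟨ ∑-concatMap (allClauses n) extensions _ ⟩
  ∑ (allClauses n) (λ c → 𝟙 (width c ≡ᵇ suc k) + (𝟙 (width c ≡ᵇ k) + (𝟙 (width c ≡ᵇ k) + 0)))
    ≡⟨ ∑-+ (allClauses n) _ _ ⟩
  count (λ c → width c ≡ᵇ suc k) (allClauses n) + ∑ (allClauses n) (λ c → 2 * 𝟙 (width c ≡ᵇ k))
    ≡⟨ cong (count (λ c → width c ≡ᵇ suc k) (allClauses n) +_) (∑-* (allClauses n) 2 _) ⟩
  count (λ c → width c ≡ᵇ suc k) (allClauses n) + 2 * count (λ c → width c ≡ᵇ k) (allClauses n)
    ≤⟨ +-mono-≤ (count-width n (suc k)) (*-monoʳ-≤ 2 (count-width n k)) ⟩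
  2 * n * (2 * n) ^ k + 2 * (2 * n) ^ k
    ≡⟨ shuffle n ((2 * n) ^ k) ⟩
  2 * suc n * (2 * n) ^ k
    ≤⟨ *-monoʳ-≤ (2 * suc n) (^-monoˡ-≤ k (*-monoʳ-≤ 2 (n≤1+n n))) ⟩
  2 * suc n * (2 * suc n) ^ k ∎
  where
  open ≤-Reasoning
  shuffle : ∀ n y → 2 * n * y + 2 * y ≡ 2 * (1 + n) * y
  shuffle = solve-∀

-- Counting variables

countᶠ : ∀ {a} → (Fin a → Bool) → ℕ
countᶠ {zero}  p = 0
countᶠ {suc a} p = 𝟙 (p zero) + countᶠ (p ∘ suc)

count-tabulate : ∀ {A : Set} {a} (p : A → Bool) (f : Fin a → A) → count p (tabulateᴸ f) ≡ countᶠ (p ∘ f)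
count-tabulate {a = zero}  p f = refl
count-tabulate {a = suc a} p f = cong (𝟙 (p (f zero)) +_) (count-tabulate p (f ∘ suc))

countᶠ-mono : ∀ {a} {p q : Fin a → Bool} → (∀ i → p i ≡ true → q i ≡ true) → countᶠ p ≤ countᶠ q
countᶠ-mono {zero}  h = z≤n
countᶠ-mono {suc a} h = +-mono-≤ (𝟙-mono (h zero)) (countᶠ-mono (h ∘ suc))

countᶠ-split : ∀ {a} (p q : Fin a → Bool) →
  countᶠ p ≡ countᶠ (λ i → p i ∧ q i) + countᶠ (λ i → p i ∧ not (q i))
countᶠ-split {zero}  p q = refl
countᶠ-split {suc a} p q rewrite countᶠ-split (p ∘ suc) (q ∘ suc) with p zero | q zero
... | false | _     = refl
... | true  | true  = refl
... | true  | false = sym (+-suc _ _)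

countᶠ-reflect : ∀ {a} {p q : Fin a → Bool} → (∀ i → p i ≡ true → q i ≡ true) →
  countᶠ q ≤ countᶠ p → ∀ i → q i ≡ true → p i ≡ true
countᶠ-reflect {suc a} {p} {q} p⇒q le i qi with p zero in p0 | q zero in q0
countᶠ-reflect {suc a} {p} {q} p⇒q le i qi | true | false = contradiction (trans (sym q0) (p⇒q zero p0)) λ ()
countᶠ-reflect {suc a} {p} {q} p⇒q le i qi | false | true =
  contradiction (≤-trans le (countᶠ-mono (p⇒q ∘ suc))) (n≮n _)
countᶠ-reflect {suc a} {p} {q} p⇒q le zero qi | true | true = p0
countᶠ-reflect {suc a} {p} {q} p⇒q le (suc i) qi | true | true = countᶠ-reflect (p⇒q ∘ suc) (≤-pred le) i qi
countᶠ-reflect {suc a} {p} {q} p⇒q le zero qi | false | false = contradiction (trans (sym q0) qi) λ ()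
countᶠ-reflect {suc a} {p} {q} p⇒q le (suc i) qi | false | false = countᶠ-reflect (p⇒q ∘ suc) le i qi

occurs : ∀ {n} → Clause n → Fin n → Bool
occurs c i = is-just (lookup c i)

width≡countᶠ : ∀ {n} (c : Clause n) → width c ≡ countᶠ (occurs c)
width≡countᶠ []            = refl
width≡countᶠ (nothing ∷ c) = width≡countᶠ c
width≡countᶠ (just _ ∷ c)  = cong suc (width≡countᶠ c)

numVars≡countᶠ : ∀ {n} (B : Formula n) → numVars B ≡ countᶠ (usesVar B)
numVars≡countᶠ {n} B = trans (length-filterᵇ (usesVar B) (allFin n)) (count-tabulate (usesVar B) id)

-- Counting tuples coordinate by coordinate

∏ : ∀ {a} → (Fin a → ℕ) → ℕ
∏ {zero}  f = 1
∏ {suc a} f = f zero * ∏ (f ∘ suc)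

∏-bound : ∀ {a} k n (z : Fin a → Bool) {f} → (∀ i → f i ≤ k * n ^ 𝟙 (z i)) → ∏ f ≤ k ^ a * n ^ countᶠ z
∏-bound {zero}  k n z h = ≤-refl
∏-bound {suc a} k n z {f} h = begin
  f zero * ∏ (f ∘ suc)                                   ≤⟨ *-mono-≤ (h zero) (∏-bound k n (z ∘ suc) (h ∘ suc)) ⟩
  k * n ^ 𝟙 (z zero) * (k ^ a * n ^ countᶠ (z ∘ suc))    ≡⟨ shuffle k (n ^ 𝟙 (z zero)) (k ^ a) (n ^ countᶠ (z ∘ suc)) ⟩
  k * k ^ a * (n ^ 𝟙 (z zero) * n ^ countᶠ (z ∘ suc))    ≡⟨ cong (k * k ^ a *_) (^-distribˡ-+-* n (𝟙 (z zero)) _) ⟨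
  k * k ^ a * n ^ (𝟙 (z zero) + countᶠ (z ∘ suc))        ∎
  where
  open ≤-Reasoning
  shuffle : ∀ a b c d → a * b * (c * d) ≡ a * c * (b * d)
  shuffle = solve-∀

tuples : ∀ {Y : Set} {a} → (Fin a → List Y) → List (Vec Y a)
tuples {a = zero}  f = [] ∷ []
tuples {a = suc a} f = concatMap (λ y → map (y ∷_) (tuples (f ∘ suc))) (f zero)

∈-tuples : ∀ {Y : Set} {a} (f : Fin a → List Y) σ → (∀ i → lookup σ i ∈ f i) → σ ∈ tuples f
∈-tuples f []      h = here refl
∈-tuples f (y ∷ σ) h = ∈-concatMap⁺ _ (Any.map (λ { refl → ∈-map⁺ (y ∷_) (∈-tuples (f ∘ suc) σ (h ∘ suc)) }) (h zero))

-- `p` is a joint condition; only its consequences for single coordinates are kept, and these can be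
-- counted independently.
count-tuples : ∀ {Y : Set} {a} (f : Fin a → List Y) (R : Fin a → Y → Bool) (p : Vec Y a → Bool) →
  (∀ σ → p σ ≡ true → ∀ i → R i (lookup σ i) ≡ true) → count p (tuples f) ≤ ∏ (λ i → count (R i) (f i))
count-tuples {a = zero}  f R p h = count≤length p ([] ∷ [])
count-tuples {a = suc a} f R p h = begin
  count p (tuples f)                                             ≡⟨ ∑-concatMap (f zero) _ _ ⟩
  ∑ (f zero) (λ y → count p (map (y ∷_) (tuples (f ∘ suc))))     ≤⟨ ∑-mono (f zero) (λ y _ → fibre y) ⟩
  ∑ (f zero) (λ y → rest * 𝟙 (R zero y))                         ≡⟨ ∑-* (f zero) rest _ ⟩
  rest * count (R zero) (f zero)                                 ≡⟨ *-comm rest _ ⟩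
  count (R zero) (f zero) * rest                                 ∎
  where
  open ≤-Reasoning
  rest = ∏ (λ i → count (R (suc i)) (f (suc i)))
  fibre : ∀ y → count p (map (y ∷_) (tuples (f ∘ suc))) ≤ rest * 𝟙 (R zero y)
  fibre y with R zero y in eq
  ... | true  = ≤-trans (≤-reflexive (∑-map (tuples (f ∘ suc)) (y ∷_) _))
        (≤-trans (count-tuples (f ∘ suc) (R ∘ suc) (λ σ → p (y ∷ σ)) (λ σ pσ i → h (y ∷ σ) pσ (suc i)))
          (≤-reflexive (sym (*-identityʳ rest))))
  ... | false = ≤-trans (≤-reflexive (trans (∑-map (tuples (f ∘ suc)) (y ∷_) _)
        (count-zero (λ σ → p (y ∷ σ)) (tuples (f ∘ suc)) (λ σ _ pσ → contradiction (trans (sym eq) (h (y ∷ σ) pσ zero)) λ ())))) z≤n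

-- Variables of a renamed clause

firstJust-just : ∀ {A : Set} {x : A} {xs} → just x ∈ xs → is-just (firstJust xs) ≡ true
firstJust-just {xs = just _ ∷ xs}  x∈         = refl
firstJust-just {xs = nothing ∷ xs} (there x∈) = firstJust-just x∈

-- Only presence is claimed: if several variables land on `σ i`, `firstJust` may return the sign of
-- another one, but it does return a sign.
rename-occurs : ∀ {a b} (σ : Fin a → Fin b) c i → occurs c i ≡ true → occurs (rename σ c) (σ i) ≡ true
rename-occurs {a} σ c i h = trans (cong is-just (lookup∘tabulate _ (σ i))) (entry (lookup c i) refl h)
  where
  g : Fin a → Maybe Bool
  g j = if ⌊ σ j ≟ᶠ σ i ⌋ then lookup c j else nothing
  g-self : g i ≡ lookup c i
  g-self with σ i ≟ᶠ σ i
  ... | yes _ = refl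
  ... | no ne = contradiction refl ne
  entry : ∀ l → lookup c i ≡ l → is-just l ≡ true → is-just (firstJust (map g (allFin a))) ≡ true
  entry (just b) eq _ = firstJust-just (subst (_∈ map g (allFin a)) (trans g-self eq) (∈-map⁺ g (∈-allFin i)))

-- Where a variable does not occur, both branches of the conditional are `nothing`. This lets
-- `copies-bound` change `σ` on the variables that the formula does not use.
rename-cong : ∀ {a b} {σ τ : Fin a → Fin b} c → (∀ i → occurs c i ≡ true → σ i ≡ τ i) → rename σ c ≡ rename τ c
rename-cong {a} {b} {σ} {τ} c h = tabulate-cong λ j → cong firstJust (map-cong (entry j) (allFin a))
  where
  entry : ∀ j i → (if ⌊ σ i ≟ᶠ j ⌋ then lookup c i else nothing) ≡ (if ⌊ τ i ≟ᶠ j ⌋ then lookup c i else nothing)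
  entry j i with lookup c i in eq
  ... | just _ rewrite h i (cong is-just eq) = refl
  ... | nothing with ⌊ σ i ≟ᶠ j ⌋ | ⌊ τ i ≟ᶠ j ⌋
  ...   | true  | true  = refl
  ...   | true  | false = refl
  ...   | false | true  = refl
  ...   | false | false = refl

open Patterns using (matches)

lookup-unique : ∀ {A : Set} {xs : List A} → Unique xs → ∀ i j → lookupᴸ xs i ≡ lookupᴸ xs j → i ≡ j
lookup-unique (x∉ ∷ u) zero    zero    eq = refl
lookup-unique (x∉ ∷ u) zero    (suc j) eq = contradiction eq (All.lookup x∉ (∈-lookup j))
lookup-unique (x∉ ∷ u) (suc i) zero    eq = contradiction (sym eq) (All.lookup x∉ (∈-lookup i))
lookup-unique (x∉ ∷ u) (suc i) (suc j) eq = cong suc (lookup-unique u i j eq)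

matches-lookup : ∀ {X : Set} (_≟_ : DecidableEquality X) {s} (π : Vec (Maybe X) s) e →
  matches _≟_ π e ≡ true → ∀ l {d} → lookup π l ≡ just d → lookup e l ≡ d
matches-lookup _≟_ (just y ∷ π)  (x ∷ e) m zero    refl = sym (Patterns.≟-true _≟_ y x (proj₁ (∧-split m)))
matches-lookup _≟_ (just y ∷ π)  (x ∷ e) m (suc l) eq   = matches-lookup _≟_ π e (proj₂ (∧-split m)) l eq
matches-lookup _≟_ (nothing ∷ π) (x ∷ e) m (suc l) eq   = matches-lookup _≟_ π e m l eq

card⇒entry : ∀ {X : Set} {s} (π : Vec (Maybe X) s) → 1 ≤ card π → ∃[ l ] ∃[ d ] (lookup π l ≡ just d)
card⇒entry (just d ∷ π)  _ = zero , d , refl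
card⇒entry (nothing ∷ π) h with card⇒entry π h
... | l , d , eq = suc l , d , eq

card⇒two-entries : ∀ {X : Set} {s} (π : Vec (Maybe X) s) → 2 ≤ card π →
  ∃[ l ] ∃[ l′ ] ∃[ d ] ∃[ d′ ] (l ≢ l′ × lookup π l ≡ just d × lookup π l′ ≡ just d′)
card⇒two-entries (nothing ∷ π) h with card⇒two-entries π h
... | l , l′ , d , d′ , l≢l′ , eq , eq′ = suc l , suc l′ , d , d′ , (λ { refl → l≢l′ refl }) , eq , eq′
card⇒two-entries (just d ∷ π)  (s≤s h) with card⇒entry π h
... | l′ , d′ , eq′ = zero , suc l′ , d , d′ , (λ ()) , refl , eq′

card≤ : ∀ {X : Set} {s} (π : Vec (Maybe X) s) → card π ≤ s
card≤ []            = z≤n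
card≤ (just _ ∷ π)  = s≤s (card≤ π)
card≤ (nothing ∷ π) = ≤-trans (card≤ π) (n≤1+n _)

-- Copies of a formula as tuples of clauses

clausesOf : ∀ {a} → Formula a → List (Clause a)
clausesOf {a} B = filterᵇ B (allClauses a)

∈-clausesOf : ∀ {a} (B : Formula a) {c} → B c ≡ true → c ∈ clausesOf B
∈-clausesOf B Bc = ∈-filterᵇ⁺ B (allClauses-complete _) Bc

clausesOf-true : ∀ {a} (B : Formula a) {c} → c ∈ clausesOf B → B c ≡ true
clausesOf-true {a} B c∈ = proj₂ (∈-filterᵇ⁻ B {xs = allClauses a} c∈)

clausesOf-unique : ∀ {a} (B : Formula a) → Unique (clausesOf B)
clausesOf-unique {a} B = Unique.filter⁺ (T? ∘ B) (allClauses-unique a)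

occurs⇒uses : ∀ {a} (B : Formula a) {c} i → B c ≡ true → occurs c i ≡ true → usesVar B i ≡ true
occurs⇒uses B i Bc oc = any⁺ (λ c → B c ∧ is-just (lookup c i)) (allClauses-complete _) (∧-join Bc oc)

InjectiveOn : ∀ {a b} → Formula a → (Fin a → Fin b) → Set
InjectiveOn B σ = ∀ i j → usesVar B i ≡ true → usesVar B j ≡ true → σ i ≡ σ j → i ≡ j

injectiveOn? : ∀ {a b} (B : Formula a) (σ : Fin a → Fin b) → Dec (InjectiveOn B σ)
injectiveOn? B σ = all? λ i → all? λ j →
  (usesVar B i ≟ᵇ true) →-dec ((usesVar B j ≟ᵇ true) →-dec ((σ i ≟ᶠ σ j) →-dec (i ≟ᶠ j)))

_∈ᶜ?_ : ∀ {n} (c : Clause n) G → Dec (c ∈ G)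
c ∈ᶜ? G = Any.any? (c ≟ᶜ_) G

-- Variables not used by B are sent to zero, so that there are only n ^ numVars B candidates.
choices : ∀ {a} ν → Formula a → Fin a → List (Fin (suc ν))
choices ν B i = if usesVar B i then allFin (suc ν) else zero ∷ []

edge : ∀ {a n} (B : Formula a) → Vec (Fin n) a → Vec (Clause n) (size B)
edge B σ = tabulate (λ l → rename (lookup σ) (lookupᴸ (clausesOf B) l))

embeds : ∀ {a n} → Formula a → List (Clause n) → Vec (Fin n) a → Bool
embeds B G σ = ⌊ injectiveOn? B (lookup σ) ⌋ ∧ ⌊ allᵛ? (_∈ᶜ? G) (edge B σ) ⌋

embeddings : ∀ {a ν} → Formula a → List (Clause (suc ν)) → List (Vec (Fin (suc ν)) a)
embeddings {ν = ν} B G = filterᵇ (embeds B G) (tuples (choices ν B))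

copies : ∀ {a ν} (B : Formula a) → List (Clause (suc ν)) → List (Vec (Clause (suc ν)) (size B))
copies B G = map (edge B) (embeddings B G)

embeds⇒injective : ∀ {a n} (B : Formula a) (G : List (Clause n)) σ → embeds B G σ ≡ true → InjectiveOn B (lookup σ)
embeds⇒injective B G σ h = toWitness {a? = injectiveOn? B (lookup σ)} (≡⇒T (proj₁ (∧-split h)))

embeds⇒⊆ : ∀ {a n} (B : Formula a) (G : List (Clause n)) σ → embeds B G σ ≡ true → VAll (_∈ G) (edge B σ)
embeds⇒⊆ B G σ h = toWitness {a? = allᵛ? (_∈ᶜ? G) (edge B σ)} (≡⇒T (proj₂ (∧-split {⌊ injectiveOn? B (lookup σ) ⌋} h)))

∈-copies : ∀ {a ν} (B : Formula a) (G : List (Clause (suc ν))) {e} → e ∈ copies B G →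
  ∃[ σ ] (e ≡ edge B σ × embeds B G σ ≡ true)
∈-copies B G e∈ with ∈-map⁻ (edge B) e∈
... | σ , σ∈ , eq = σ , eq , proj₂ (∈-filterᵇ⁻ (embeds B G) {xs = tuples (choices _ B)} σ∈)

copies⊆ : ∀ {a ν} (B : Formula a) (G : List (Clause (suc ν))) e → e ∈ copies B G → VAll (_∈ G) e
copies⊆ B G e e∈ with ∈-copies B G e∈
... | σ , refl , em = embeds⇒⊆ B G σ em

image : ∀ {a n} → Formula a → (Fin a → Fin n) → Formula n
image B σ c = any (λ c′ → ⌊ rename σ c′ ≟ᶜ c ⌋) (clausesOf B)

image-relabels : ∀ {a n} (B : Formula a) (σ : Fin a → Fin n) → InjectiveOn B σ → Relabels B (image B σ)
image-relabels B σ inj = σ , inj , λ c → to c , from c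
  where
  to : ∀ c → image B σ c ≡ true → ∃[ c′ ] (B c′ ≡ true × rename σ c′ ≡ c)
  to c h with any⁻ _ (clausesOf B) h
  ... | c′ , c′∈ , eq = c′ , clausesOf-true B c′∈ , Patterns.≟-true _≟ᶜ_ _ _ eq
  from : ∀ c → ∃[ c′ ] (B c′ ≡ true × rename σ c′ ≡ c) → image B σ c ≡ true
  from c (c′ , Bc′ , refl) = any⁺ (λ c″ → ⌊ rename σ c″ ≟ᶜ c ⌋) (∈-clausesOf B Bc′) (Patterns.≟-refl _≟ᶜ_ (rename σ c′))

edge-all : ∀ {a n} (B : Formula a) (σ : Vec (Fin n) a) {P : Clause n → Set} → VAll P (edge B σ) →
  ∀ c′ → B c′ ≡ true → P (rename (lookup σ) c′)
edge-all B σ {P} all c′ Bc′ = subst P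
  (trans (lookup∘tabulate _ l) (cong (rename (lookup σ)) (sym (Any.lookup-index c′∈)))) (lookup⁺ all l)
  where
  c′∈ = ∈-clausesOf B Bc′
  l = Any.index c′∈

free⇒independent : ∀ {a ν} (B : Formula a) (G : List (Clause (suc ν))) F → (∀ S → ¬ IsCopy B F S) →
  Independent (copies B G) F
free⇒independent B G F free e e∈ e⊆F with ∈-copies B G e∈
... | σ , refl , em = free (image B (lookup σ)) (image⊆F , relabels)
  where
  relabels = image-relabels B (lookup σ) (embeds⇒injective B G σ em)
  image⊆F : image B (lookup σ) ⊆F F
  image⊆F c h with proj₁ (proj₂ (proj₂ relabels) c) h
  ... | c′ , Bc′ , refl = edge-all B σ {λ c → F c ≡ true} e⊆F c′ Bc′

-- Degrees of partially prescribed copies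

module SimpleFormula {a} (k : ℕ) (B : Formula a) (ksat : IsKSAT k B) (simple : Simple B) where

  clause : Fin (size B) → Clause a
  clause = lookupᴸ (clausesOf B)

  clause∈B : ∀ l → B (clause l) ≡ true
  clause∈B l = clausesOf-true B (∈-lookup l)

  free-vars : (Fin a → Bool) → Fin a → Bool
  free-vars U i = usesVar B i ∧ not (U i)

  free-vars-count : ∀ U → (∀ i → U i ≡ true → usesVar B i ≡ true) →
    countᶠ U + countᶠ (free-vars U) ≤ numVars B
  free-vars-count U U⊆ = begin
    countᶠ U + countᶠ (free-vars U)                                 ≤⟨ +-monoˡ-≤ _ (countᶠ-mono λ i Ui → ∧-join (U⊆ i Ui) Ui) ⟩
    countᶠ (λ i → usesVar B i ∧ U i) + countᶠ (free-vars U)         ≡⟨ countᶠ-split (usesVar B) U ⟨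
    countᶠ (usesVar B)                                              ≡⟨ numVars≡countᶠ B ⟨
    numVars B                                                       ∎
    where open ≤-Reasoning

  clause-size : ∀ l → countᶠ (occurs (clause l)) ≡ k
  clause-size l = trans (sym (width≡countᶠ (clause l))) (ksat _ (clause∈B l))

  clause-uses : ∀ l i → occurs (clause l) i ≡ true → usesVar B i ≡ true
  clause-uses l i = occurs⇒uses B i (clause∈B l)

  -- Otherwise both clauses would use exactly the same k variables.
  two-clauses : ∀ l l′ → l ≢ l′ → suc k ≤ countᶠ (λ i → occurs (clause l) i ∨ occurs (clause l′) i)
  two-clauses l l′ l≢l′ = ≰⇒> λ le → l≢l′ (lookup-unique (clausesOf-unique B) l l′
    (simple _ _ (clause∈B l) (clause∈B l′) λ i → ≡-iff
      (λ o → countᶠ-reflect {p = p′} (λ j → ∨-right (p j)) (≤-trans le (≤-reflexive (sym (clause-size l′)))) i (∨-left (p i) o))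
      (λ o → countᶠ-reflect {p = p} (λ j → ∨-left (p j)) (≤-trans le (≤-reflexive (sym (clause-size l)))) i (∨-right (p i) o))))
    where
    p = occurs (clause l)
    p′ = occurs (clause l′)
    ∨-left : ∀ a {b} → a ≡ true → a ∨ b ≡ true
    ∨-left true _ = refl
    ∨-right : ∀ a {b} → b ≡ true → a ∨ b ≡ true
    ∨-right true  _ = refl
    ∨-right false h = h
    ≡-iff : ∀ {a b} → (a ≡ true → b ≡ true) → (b ≡ true → a ≡ true) → a ≡ b
    ≡-iff {true}  {b}     f g = sym (f refl)
    ≡-iff {false} {true}  f g = g refl
    ≡-iff {false} {false} f g = refl

module Degrees {a} ν (k : ℕ) (1≤k : 1 ≤ k) (B : Formula a) (ksat : IsKSAT k B) (simple : Simple B)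
  (G : List (Clause (suc ν))) (widthG : ∀ c → c ∈ G → width c ≡ k) where

  open SimpleFormula k B ksat simple

  n = suc ν

  fits : Vec (Maybe (Clause n)) (size B) → Vec (Fin n) a → Bool
  fits π σ = embeds B G σ ∧ matches _≟ᶜ_ π (edge B σ)

  count-copies : ∀ π → count (matches _≟ᶜ_ π) (copies B G) ≡ count (fits π) (tuples (choices ν B))
  count-copies π = trans (∑-map (embeddings B G) (edge B) _) (count-filterᵇ (embeds B G) _ (tuples (choices ν B)))

  fits-entry : ∀ π σ → fits π σ ≡ true → ∀ l {d} → lookup π l ≡ just d →
    rename (lookup σ) (clause l) ≡ d × width d ≡ k
  fits-entry π σ f l {d} eq = renamed , widthG d (subst (_∈ G) entry (lookup⁺ (embeds⇒⊆ B G σ (proj₁ (∧-split f))) l))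
    where
    entry : lookup (edge B σ) l ≡ d
    entry = matches-lookup _≟ᶜ_ π (edge B σ) (proj₂ (∧-split {embeds B G σ} f)) l eq
    renamed : rename (lookup σ) (clause l) ≡ d
    renamed = trans (sym (lookup∘tabulate _ l)) entry

  fits-occurs : ∀ π σ → fits π σ ≡ true → ∀ l {d} → lookup π l ≡ just d → ∀ i →
    occurs (clause l) i ≡ true → occurs d (lookup σ i) ≡ true
  fits-occurs π σ f l eq i oc with fits-entry π σ f l eq
  ... | refl , _ = rename-occurs (lookup σ) (clause l) i oc

  count-occurs : ∀ d → width d ≡ k → count (occurs d) (allFin n) ≤ k
  count-occurs d wd = ≤-reflexive (trans (count-tabulate (occurs d) id) (trans (sym (width≡countᶠ d)) wd))

  region-bound : ∀ π (U : Fin a → Bool) (R : Fin a → Fin n → Bool) →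
    (∀ σ → fits π σ ≡ true → ∀ i → U i ≡ true → R i (lookup σ i) ≡ true) →
    (∀ i → U i ≡ true → count (R i) (allFin n) ≤ k) →
    count (fits π) (tuples (choices ν B)) ≤ k ^ a * n ^ countᶠ (free-vars U)
  region-bound π U R forced small = ≤-trans
    (count-tuples (choices ν B) (λ i y → not (U i) ∨ R i y) (fits π) allowed)
    (∏-bound k n (free-vars U) factor)
    where
    open ≤-Reasoning
    allowed : ∀ σ → fits π σ ≡ true → ∀ i → not (U i) ∨ R i (lookup σ i) ≡ true
    allowed σ f i with U i in eq
    ... | false = refl
    ... | true  = forced σ f i eq
    factor : ∀ i → count (λ y → not (U i) ∨ R i y) (choices ν B i) ≤ k * n ^ 𝟙 (usesVar B i ∧ not (U i))
    factor i with usesVar B i | U i in eq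
    ... | false | b = ≤-trans (count≤length (λ y → not b ∨ R i y) (zero ∷ [])) (≤-trans 1≤k (≤-reflexive (sym (*-identityʳ k))))
    ... | true | true  = ≤-trans (small i eq) (≤-reflexive (sym (*-identityʳ k)))
    ... | true | false = begin
      count (λ _ → true) (allFin n)  ≤⟨ count≤length (λ _ → true) (allFin n) ⟩
      length (allFin n)              ≡⟨ length-tabulate {n = n} id ⟩
      n                              ≡⟨ *-identityˡ n ⟨
      1 * n                          ≤⟨ *-monoˡ-≤ n 1≤k ⟩
      k * n                          ≡⟨ cong (k *_) (*-identityʳ n) ⟨
      k * n ^ 1                      ∎

  -- Once a clause of `B` must become `d`, its `k` variables go to the `k` variables of `d`, and at
  -- most `numVars B ∸ k` variables range freely.
  degree-one : ∀ π → 1 ≤ card π → count (matches _≟ᶜ_ π) (copies B G) ≤ k ^ a * n ^ (numVars B ∸ k)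
  degree-one π 1≤π rewrite count-copies π with count-zero⊎witness (fits π) (tuples (choices ν B))
  ... | inj₁ none rewrite none = z≤n
  -- A fitting embedding shows that `d` lies in `G` and so has width `k`; without one there is
  -- nothing to count.
  ... | inj₂ (τ , _ , fτ) with card⇒entry π 1≤π
  ...   | l , d , eq = ≤-trans
          (region-bound π U (λ _ → occurs d) (λ σ f → fits-occurs π σ f l eq)
            (λ _ _ → count-occurs d (proj₂ (fits-entry π τ fτ l eq))))
          (*-monoʳ-≤ (k ^ a) (^-monoʳ-≤ n (m+n≤o⇒n≤o∸m k (subst (λ c → c + countᶠ (free-vars U) ≤ numVars B) (clause-size l) (free-vars-count U (clause-uses l))))))
    where
    U = occurs (clause l)
    m+n≤o⇒n≤o∸m : ∀ m {n o} → m + n ≤ o → n ≤ o ∸ m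
    m+n≤o⇒n≤o∸m m {n} le = ≤-trans (≤-reflexive (sym (m+n∸m≡n m n))) (∸-monoˡ-≤ m le)

  -- Two distinct clauses of a simple formula fix at least `k + 1` variables, one more than in
  -- `degree-one`, and this saves a factor `n`.
  degree-two : ∀ π → 2 ≤ card π → count (matches _≟ᶜ_ π) (copies B G) * n ≤ k ^ a * n ^ (numVars B ∸ k)
  degree-two π 2≤π rewrite count-copies π with count-zero⊎witness (fits π) (tuples (choices ν B))
  ... | inj₁ none rewrite none = z≤n
  ... | inj₂ (τ , _ , fτ) with card⇒two-entries π 2≤π
  ...   | l , l′ , d , d′ , l≢l′ , eq , eq′ = begin
    count (fits π) (tuples (choices ν B)) * n       ≤⟨ *-monoˡ-≤ n (region-bound π U R forced small) ⟩
    k ^ a * n ^ countᶠ (free-vars U) * n            ≡⟨ shuffle (k ^ a) (n ^ countᶠ (free-vars U)) n ⟩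
    k ^ a * n ^ suc (countᶠ (free-vars U))          ≤⟨ *-monoʳ-≤ (k ^ a) (^-monoʳ-≤ n room) ⟩
    k ^ a * n ^ (numVars B ∸ k)                     ∎
    where
    open ≤-Reasoning
    U : Fin a → Bool
    U i = occurs (clause l) i ∨ occurs (clause l′) i
    -- A variable common to both clauses is constrained through `d` alone.
    R : Fin a → Fin n → Bool
    R i y = if occurs (clause l) i then occurs d y else occurs d′ y
    forced : ∀ σ → fits π σ ≡ true → ∀ i → U i ≡ true → R i (lookup σ i) ≡ true
    forced σ f i Ui with occurs (clause l) i in o
    ... | true  = fits-occurs π σ f l eq i o
    ... | false = fits-occurs π σ f l′ eq′ i Ui
    small : ∀ i → U i ≡ true → count (R i) (allFin n) ≤ k
    small i Ui with occurs (clause l) i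
    ... | true  = count-occurs d (proj₂ (fits-entry π τ fτ l eq))
    ... | false = count-occurs d′ (proj₂ (fits-entry π τ fτ l′ eq′))
    uses : ∀ i → U i ≡ true → usesVar B i ≡ true
    uses i Ui with occurs (clause l) i in o
    ... | true  = clause-uses l i o
    ... | false = clause-uses l′ i Ui
    room : suc (countᶠ (free-vars U)) ≤ numVars B ∸ k
    room = ≤-trans (≤-reflexive (sym (m+n∸m≡n k _))) (∸-monoˡ-≤ k (≤-trans (≤-reflexive (+-suc k _))
      (≤-trans (+-monoˡ-≤ (countᶠ (free-vars U)) (two-clauses l l′ l≢l′)) (free-vars-count U uses))))
    shuffle : ∀ p q n → p * q * n ≡ p * (n * q)
    shuffle = solve-∀

  -- Here t is the rounded root of n: t ^ (size B ∸ 1) ≤ n is what lets a single extra variable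
  -- pay for any number of prescribed clauses.
  copies-capped : ∀ t → 1 ≤ t → t ^ (size B ∸ 1) ≤ n → ∀ π → 1 ≤ card π →
    t ^ card π * count (matches _≟ᶜ_ π) (copies B G) ≤ k ^ a * (t * n ^ (numVars B ∸ k))
  copies-capped t 1≤t root π 1≤π with card π in eq
  ... | suc zero    = begin
      t * 1 * count (matches _≟ᶜ_ π) (copies B G)   ≤⟨ *-monoʳ-≤ (t * 1) (degree-one π (≤-reflexive (sym eq))) ⟩
      t * 1 * (k ^ a * n ^ (numVars B ∸ k))         ≡⟨ shuffle t (k ^ a) _ ⟩
      k ^ a * (t * n ^ (numVars B ∸ k))             ∎
    where
    open ≤-Reasoning
    shuffle : ∀ t p q → t * 1 * (p * q) ≡ p * (t * q)
    shuffle = solve-∀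
  ... | suc (suc j) = begin
      t * t ^ suc j * c                             ≤⟨ *-monoˡ-≤ c (*-monoʳ-≤ t (≤-trans (^-monoʳ-≤ t {{>-nonZero 1≤t}} j<) root)) ⟩
      t * n * c                                     ≡⟨ shuffle t n c ⟩
      t * (c * n)                                   ≤⟨ *-monoʳ-≤ t (degree-two π (≤-trans (s≤s (s≤s z≤n)) (≤-reflexive (sym eq)))) ⟩
      t * (k ^ a * n ^ (numVars B ∸ k))             ≡⟨ shuffle′ t (k ^ a) _ ⟩
      k ^ a * (t * n ^ (numVars B ∸ k))             ∎
    where
    open ≤-Reasoning
    c = count (matches _≟ᶜ_ π) (copies B G)
    j< : suc j ≤ size B ∸ 1
    j< = ∸-monoˡ-≤ 1 (subst (_≤ size B) eq (card≤ π))
    shuffle : ∀ t n c → t * n * c ≡ t * (c * n)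
    shuffle = solve-∀
    shuffle′ : ∀ t p q → t * (p * q) ≡ p * (t * q)
    shuffle′ = solve-∀

-- Counting copies by embeddings

toFormula : ∀ {n} → List (Clause n) → Formula n
toFormula G c = ⌊ c ∈ᶜ? G ⌋

∈⇒toFormula : ∀ {n} (G : List (Clause n)) c → c ∈ G → toFormula G c ≡ true
∈⇒toFormula G c c∈ = T⇒≡ (fromWitness {a? = c ∈ᶜ? G} c∈)

toFormula⇒∈ : ∀ {n} (G : List (Clause n)) c → toFormula G c ≡ true → c ∈ G
toFormula⇒∈ G c h = toWitness {a? = c ∈ᶜ? G} (≡⇒T h)

-- Pigeonhole for a relation: when the partner of `x` is removed, `clash` ensures that no element
-- different from `x` loses its own. A relation suits formulae, which are functions told apart only
-- by a clause where they differ.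
length-≤-by-image : ∀ {X Y : Set} {_#_ : X → X → Set} {R : X → Y → Set} →
  (∀ {x x′ y} → R x y → R x′ y → ¬ (x # x′)) → ∀ (xs : List X) (ys : List Y) →
  AllPairs _#_ xs → All (λ x → Any (R x) ys) xs → length xs ≤ length ys
length-≤-by-image {X} {Y} {_#_} {R} clash = go
  where
  remove : ∀ {x} (ys : List Y) → Any (R x) ys → ∃[ zs ] (length ys ≡ suc (length zs) ×
    (∀ {x′} → x # x′ → Any (R x′) ys → Any (R x′) zs))
  remove (y ∷ ys) (here r) = ys , refl , λ where
    x#x′ (here r′) → contradiction x#x′ (clash r r′)
    x#x′ (there a) → a
  remove (y ∷ ys) (there r) with remove ys r
  ... | zs , eq , keep = y ∷ zs , cong suc eq , λ where
    x#x′ (here r′) → here r′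
    x#x′ (there a) → there (keep x#x′ a)
  go : ∀ xs ys → AllPairs _#_ xs → All (λ x → Any (R x) ys) xs → length xs ≤ length ys
  go []       ys []           []       = z≤n
  go (x ∷ xs) ys (x# ∷ pairs) (r ∷ rs) with remove ys r
  ... | zs , eq , keep = ≤-trans (s≤s (go xs zs pairs (All.map (λ (s , a) → keep s a) (All.zip (x# , rs))))) (≤-reflexive (sym eq))

-- An embedding determines every value of the formula that it realises, so different copies need
-- different embeddings.
copies-bound : ∀ {a ν} p q (B : Formula a) (G : List (Clause (suc ν))) →
  q * length (copies B G) ≤ p * suc ν ^ numVars B → CopiesBound p q (a , B) (toFormula G)
copies-bound {a} {ν} p q B G bound L isCopies distinct = ≤-trans (*-monoʳ-≤ q
  (≤-trans (length-≤-by-image {R = Realises} (λ {S} {S′} {σ} → clash {S} {S′} {σ}) L (embeddings B G) distinct (All.map realise isCopies))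
    (≤-reflexive (sym (length-map (edge B) (embeddings B G)))))) bound
  where
  n = suc ν
  Realises : Formula n → Vec (Fin n) a → Set
  Realises S σ = ∀ c → (S c ≡ true → ∃[ c′ ] (B c′ ≡ true × rename (lookup σ) c′ ≡ c)) ×
                       ((∃[ c′ ] (B c′ ≡ true × rename (lookup σ) c′ ≡ c)) → S c ≡ true)
  clash : ∀ {S S′ σ} → Realises S σ → Realises S′ σ → ¬ DifferentF S S′
  clash {S} {S′} r r′ (c , neq) with S c in eq | S′ c in eq′
  ... | true  | true  = neq refl
  ... | false | false = neq refl
  ... | true  | false = contradiction (trans (sym eq′) (proj₂ (r′ c) (proj₁ (r c) eq))) λ ()
  ... | false | true  = contradiction (trans (sym eq) (proj₂ (r c) (proj₁ (r′ c) eq′))) λ ()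
  realise : ∀ {S} → IsCopy B (toFormula G) S → Any (Realises S) (embeddings B G)
  realise {S} (S⊆G , σ , inj , iff) = Any.map (λ { refl → realises }) τ∈
    where
    τ : Vec (Fin n) a
    τ = tabulate (λ i → if usesVar B i then σ i else zero)
    τ≡σ : ∀ i → usesVar B i ≡ true → lookup τ i ≡ σ i
    τ≡σ i u = trans (lookup∘tabulate _ i) (cong (λ b → if b then σ i else zero) u)
    same : ∀ c′ → B c′ ≡ true → rename (lookup τ) c′ ≡ rename σ c′
    same c′ Bc′ = rename-cong c′ λ i oc → τ≡σ i (occurs⇒uses B i Bc′ oc)
    realises : Realises S τ
    realises c = (λ Sc → let c′ , Bc′ , eq = proj₁ (iff c) Sc in c′ , Bc′ , trans (same c′ Bc′) eq) ,
                 (λ (c′ , Bc′ , eq) → proj₂ (iff c) (c′ , Bc′ , trans (sym (same c′ Bc′)) eq))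
    τ-inj : InjectiveOn B (lookup τ)
    τ-inj i j ui uj eq = inj i j ui uj (trans (sym (τ≡σ i ui)) (trans eq (τ≡σ j uj)))
    τ-choice : ∀ i → lookup τ i ∈ choices ν B i
    τ-choice i rewrite lookup∘tabulate (λ i → if usesVar B i then σ i else zero) i with usesVar B i
    ... | true  = ∈-allFin (σ i)
    ... | false = here refl
    τ⊆G : VAll (_∈ G) (edge B τ)
    τ⊆G = tabulateᵛ λ l → let Bl = clausesOf-true B (∈-lookup {xs = clausesOf B} l) in
      toFormula⇒∈ G _ (S⊆G _ (proj₂ (iff _) (lookupᴸ (clausesOf B) l , Bl , sym (same _ Bl))))
    τ∈ : τ ∈ embeddings B G
    τ∈ = ∈-filterᵇ⁺ (embeds B G) (∈-tuples (choices ν B) τ τ-choice)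
      (∧-join (T⇒≡ (fromWitness {a? = injectiveOn? B (lookup τ)} τ-inj))
              (T⇒≡ (fromWitness {a? = allᵛ? (_∈ᶜ? G) (edge B τ)} τ⊆G)))

-- Arithmetic of the bound

^-distribʳ-* : ∀ o m n → (m * n) ^ o ≡ m ^ o * n ^ o
^-distribʳ-* zero    m n = refl
^-distribʳ-* (suc o) m n = trans (cong (m * n *_) (^-distribʳ-* o m n)) (shuffle m n (m ^ o) (n ^ o))
  where
  shuffle : ∀ a b c d → a * b * (c * d) ≡ a * c * (b * d)
  shuffle = solve-∀

-- When `n` grows by one, its rounded root grows by at most one. Writing `2 * t` for `t + 1` in the
-- upper bound loses a constant factor that `power-bound` absorbs.
integer-root : ∀ e n → 1 ≤ e → 1 ≤ n → ∃[ t ] (1 ≤ t × t ^ e ≤ n × n ≤ (2 * t) ^ e)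
integer-root (suc e) (suc m) _ _ with search m
  where
  search : ∀ m → ∃[ t ] (suc t ^ suc e ≤ suc m × suc m < suc (suc t) ^ suc e)
  search zero = 0 , ≤-reflexive (^-zeroˡ (suc e)) , ^-monoʳ-≤ 2 {1} {suc e} (s≤s z≤n)
  search (suc m) with search m
  ... | t , low , high with suc (suc t) ^ suc e ≤? suc (suc m)
  ...   | yes le = suc t , le , ≤-<-trans high (^-monoˡ-< (suc e) (n<1+n (suc (suc t))))
  ...   | no nle = t , ≤-trans low (n≤1+n _) , ≰⇒> nle
... | t , low , high = suc t , s≤s z≤n , low , ≤-trans (<⇒≤ high) (^-monoˡ-≤ (suc e) double)
  where
  double : suc (suc t) ≤ 2 * suc t
  double = s≤s (≤-trans (s≤s (m≤m+n t 0)) (m≤n+m _ t))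

-- If `b < E * x * a`, multiplying `b ^ (m ∸ 1)` by `n ≤ (2 * t) ^ (m ∸ 1)` produces `x * t`, so `t`
-- disappears, and cancelling one `n` contradicts the assumption on `b`. The `4` combines the `2` of
-- the rounded root with that of `x * t ≤ 2 * n ^ k`.
power-bound : ∀ E k m n t x L → 1 ≤ k → 2 ≤ m → 1 ≤ n → n ≤ (2 * t) ^ (m ∸ 1) → x * t ≤ 2 * n ^ k →
  L ≤ n ^ (E * x) → PowBound (4 * E) k m n L
power-bound E (suc k) (suc (suc e₀)) n t x L _ (s≤s (s≤s _)) 1≤n n≤ xt≤ L≤ a b _ lt = begin
  L ^ a             ≤⟨ ^-monoˡ-≤ a L≤ ⟩
  (n ^ (E * x)) ^ a ≡⟨ ^-*-assoc n (E * x) a ⟩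
  n ^ (E * x * a)   ≤⟨ ^-monoʳ-≤ n {{>-nonZero 1≤n}} exponent ⟩
  n ^ b             ∎
  where
  open ≤-Reasoning
  e = suc e₀
  shuffle : ∀ E x a t → 2 * t * (E * x * a) ≡ 2 * (E * a) * (x * t)
  shuffle = solve-∀
  shuffle′ : ∀ E a y → 2 * (E * a) * (2 * y) ≡ 4 * E * a * y
  shuffle′ = solve-∀
  exponent : E * x * a ≤ b
  exponent with E * x * a ≤? b
  ... | yes le = le
  ... | no nle = contradiction (cancel-* 1≤n (begin
      n * b ^ e                              ≤⟨ *-monoˡ-≤ (b ^ e) n≤ ⟩
      (2 * t) ^ e * b ^ e                    ≡⟨ ^-distribʳ-* e (2 * t) b ⟨
      (2 * t * b) ^ e                        ≤⟨ ^-monoˡ-≤ e (*-monoʳ-≤ (2 * t) (<⇒≤ (≰⇒> nle))) ⟩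
      (2 * t * (E * x * a)) ^ e              ≡⟨ cong (_^ e) (shuffle E x a t) ⟩
      (2 * (E * a) * (x * t)) ^ e            ≤⟨ ^-monoˡ-≤ e (*-monoʳ-≤ (2 * (E * a)) xt≤) ⟩
      (2 * (E * a) * (2 * n ^ suc k)) ^ e    ≡⟨ cong (_^ e) (shuffle′ E a (n ^ suc k)) ⟩
      (4 * E * a * n ^ suc k) ^ e            ≡⟨ ^-distribʳ-* e (4 * E * a) (n ^ suc k) ⟩
      (4 * E * a) ^ e * (n ^ suc k) ^ e      ≡⟨ cong ((4 * E * a) ^ e *_) (^-*-assoc n (suc k) e) ⟩
      (4 * E * a) ^ e * (n * n ^ (e₀ + k * e)) ≡⟨ reorder ((4 * E * a) ^ e) n (n ^ (e₀ + k * e)) ⟩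
      n * ((4 * E * a) ^ e * n ^ (suc k * e ∸ 1)) ∎)) (<⇒≱ lt)
    where
    reorder : ∀ p n q → p * (n * q) ≡ n * (p * q)
    reorder = solve-∀

-- The left side is the branching number of the tree; bounding it by a power of `n` turns the number
-- of leaves into a power of `n`.
fingerprint-base : ∀ k n → 2 ≤ n → suc (2 ^ k * n ^ k) ≤ n ^ suc (k + k)
fingerprint-base k n 2≤n = begin
  suc (2 ^ k * n ^ k)   ≤⟨ s≤s (*-monoˡ-≤ (n ^ k) (^-monoˡ-≤ k 2≤n)) ⟩
  suc (n ^ k * n ^ k)   ≡⟨ cong suc (^-distribˡ-+-* n k k) ⟨
  1 + n ^ (k + k)       ≤⟨ +-monoˡ-≤ _ (pos-^ (≤-trans (s≤s z≤n) 2≤n) (k + k)) ⟩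
  n ^ (k + k) + n ^ (k + k) ≡⟨ cong (n ^ (k + k) +_) (+-identityʳ _) ⟨
  2 * n ^ (k + k)       ≤⟨ *-monoˡ-≤ (n ^ (k + k)) 2≤n ⟩
  n * n ^ (k + k)       ∎
  where open ≤-Reasoning

size≤maxSize : ∀ {B : AnyFormula} {𝓑} → B ∈ 𝓑 → size (proj₂ B) ≤ maxSize 𝓑
size≤maxSize {𝓑 = B ∷ 𝓑} (here refl) = m≤m⊔n _ (maxSize 𝓑)
size≤maxSize {𝓑 = B ∷ 𝓑} (there B∈)  = ≤-trans (size≤maxSize B∈) (m≤n⊔m (size (proj₂ B)) _)

countᶠ⇒witness : ∀ {a} (p : Fin a → Bool) → 1 ≤ countᶠ p → ∃[ i ] (p i ≡ true)
countᶠ⇒witness {suc a} p h with p zero in eq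
... | true  = zero , eq
... | false with countᶠ⇒witness (p ∘ suc) h
...   | i , pi = suc i , pi

countᶠ⇒two-witnesses : ∀ {a} (p : Fin a → Bool) → 2 ≤ countᶠ p → ∃[ i ] ∃[ j ] (i ≢ j × p i ≡ true × p j ≡ true)
countᶠ⇒two-witnesses {suc a} p h with p zero in eq
... | true  with countᶠ⇒witness (p ∘ suc) (≤-pred h)
...   | j , pj = zero , suc j , (λ ()) , eq , pj
countᶠ⇒two-witnesses {suc a} p h | false with countᶠ⇒two-witnesses (p ∘ suc) h
...   | i , j , i≢j , pi , pj = suc i , suc j , (λ { refl → i≢j refl }) , pi , pj

nonempty : ∀ {A : Set} (xs : List A) → 1 ≤ length xs → ∃[ x ] (x ∈ xs)
nonempty (x ∷ xs) _ = x , here refl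

-- Iterating the shrinking step

module Containers (k : ℕ) (1≤k : 1 ≤ k) (𝓑 : List AnyFormula)
  (hyp : All (λ B → IsKSAT k (proj₂ B) × Simple (proj₂ B)) 𝓑)
  (p q : ℕ) (1≤p : 1 ≤ p) (1≤q : 1 ≤ q) where

  Q = 2 ^ k

  -- `k ^ a` is the degree constant of `copies-capped`, and `q` the saturation constant of a formula
  -- that is not sparse, whose density exceeds `p / q` and hence `1 / q`. The sums over `𝓑` cover
  -- whichever formula is dense at a given stage.
  lossOf depthOf : AnyFormula → ℕ
  lossOf  (a , B) = loss (size B) (k ^ a) q
  depthOf (a , B) = depth Q (size B) (k ^ a) q

  totalLoss = ∑ 𝓑 lossOf
  totalDepth = ∑ 𝓑 depthOf

  Sparse : ∀ {ν} → List (Clause (suc ν)) → AnyFormula → Set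
  Sparse {ν} G (a , B) = q * length (copies B G) ≤ p * suc ν ^ numVars B

  Good : ∀ {ν} → List (Clause (suc ν)) → Set
  Good G = (∀ c → c ∈ G → width c ≡ k) × All (Sparse G) 𝓑

  FreeIn : ∀ {ν} → List (Clause (suc ν)) → Formula (suc ν) → Set
  FreeIn G F = Free 𝓑 F × (∀ c → F c ≡ true → c ∈ G)

  freeIn⇒independent : ∀ {ν a} {B : Formula a} (G : List (Clause (suc ν))) → (a , B) ∈ 𝓑 →
    ∀ F → FreeIn G F → Independent (copies B G) F
  freeIn⇒independent {B = B} G B∈ F (free , _) = free⇒independent B G F (free (_ , B) B∈)

  sparse-or-dense : ∀ {ν} (G : List (Clause (suc ν))) → All (Sparse G) 𝓑 ⊎ ∃[ B ] (B ∈ 𝓑 × ¬ Sparse G B)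
  sparse-or-dense {ν} G with All.decide (λ B → decide B) 𝓑
    where
    decide : ∀ B → Sparse G B ⊎ ¬ Sparse G B
    decide (a , B) with q * length (copies B G) ≤? p * suc ν ^ numVars B
    ... | yes le = inj₁ le
    ... | no nle = inj₂ nle
  ... | inj₁ all = inj₁ all
  ... | inj₂ some = inj₂ (find some)

  covered-by-itself : ∀ {ν c} (G : List (Clause (suc ν))) → 1 ≤ c → Good G → CoveredBy Good c (FreeIn G)
  covered-by-itself G 1≤c good = G ∷ [] , 1≤c , good ∷ [] , λ F (_ , F⊆G) → here F⊆G

  dense⇒nonempty : ∀ {ν a} {B : Formula a} (G : List (Clause (suc ν))) → ¬ Sparse G (a , B) →
    suc ν ^ numVars B ≤ q * length (copies B G) × ∃[ e ] (e ∈ copies B G)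
  dense⇒nonempty {ν} {a} {B} G dense = many , nonempty _ (positive (≤-trans (pos-^ {suc ν} (s≤s z≤n) (numVars B)) many))
    where
    many : suc ν ^ numVars B ≤ q * length (copies B G)
    many = ≤-trans (≤-trans (≤-reflexive (sym (*-identityˡ _))) (*-monoˡ-≤ (suc ν ^ numVars B) 1≤p)) (<⇒≤ (≰⇒> dense))
    positive : ∀ {l} → 1 ≤ q * l → 1 ≤ l
    positive {zero}  h = contradiction (≤-trans h (≤-reflexive (*-zeroʳ q))) λ ()
    positive {suc l} h = s≤s z≤n

  remaining : ∀ {ν} → (Clause (suc ν) → Bool) → List (Clause (suc ν)) → List (Clause (suc ν))
  remaining u G = filterᵇ (not ∘ u) G

  freeIn-remaining : ∀ {ν} u (G : List (Clause (suc ν))) F → FreeIn G F × Avoids u G F → FreeIn (remaining u G) F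
  freeIn-remaining u G F ((free , F⊆G) , av) = free , λ c Fc → ∈-filterᵇ⁺ (not ∘ u) (F⊆G c Fc) (unused c Fc)
    where
    unused : ∀ c → F c ≡ true → not (u c) ≡ true
    unused c Fc with u c in uc
    ... | false = refl
    ... | true  = contradiction (trans (sym (av c (F⊆G c Fc) uc)) Fc) λ ()

  remaining-width : ∀ {ν} u (G : List (Clause (suc ν))) → (∀ c → c ∈ G → width c ≡ k) →
    ∀ c → c ∈ remaining u G → width c ≡ k
  remaining-width u G widthG c c∈ = widthG c (proj₁ (∈-filterᵇ⁻ (not ∘ u) {xs = G} c∈))

  length-remaining : ∀ {ν} u (G : List (Clause (suc ν))) → count u G + length (remaining u G) ≡ length G
  length-remaining u G = trans (cong (count u G +_) (length-filterᵇ (not ∘ u) G)) (count-not u G)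

  -- For n = 1 the bound allows a single container; by the following lemma no branching is needed there.
  size≤1 : ∀ {a} {B : Formula a} → (a , B) ∈ 𝓑 → ∀ (σ : Vec (Fin 1) a) → InjectiveOn B (lookup σ) → size B ≤ 1
  size≤1 {a} {B} B∈ σ inj with size B ≤? 1
  ... | yes le = le
  ... | no nle with two-indices (≰⇒> nle)
    where
    two-indices : ∀ {s} → 2 ≤ s → Σ (Fin s) λ l → Σ (Fin s) λ l′ → l ≢ l′
    two-indices (s≤s (s≤s _)) = zero , suc zero , λ ()
  ...   | l , l′ , l≢l′ with countᶠ⇒two-witnesses _ (≤-trans (s≤s 1≤k) (two-clauses l l′ l≢l′))
    where open SimpleFormula k B (proj₁ (All.lookup hyp B∈)) (proj₂ (All.lookup hyp B∈))
  ...     | i , j , i≢j , ui , uj = contradiction (inj i j (uses i ui) (uses j uj) (fin1 _ _)) i≢j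
    where
    open SimpleFormula k B (proj₁ (All.lookup hyp B∈)) (proj₂ (All.lookup hyp B∈))
    uses : ∀ i → occurs (clause l) i ∨ occurs (clause l′) i ≡ true → usesVar B i ≡ true
    uses i o with occurs (clause l) i in eq
    ... | true  = clause-uses l i eq
    ... | false = clause-uses l′ i o
    fin1 : ∀ (x y : Fin 1) → x ≡ y
    fin1 zero zero = refl

  -- A dense formula has at most one clause here. With none, no `F` is free; with one, every free
  -- `F` avoids the clause found, which is deleted without branching. `w` bounds the deletions still
  -- possible.
  containers-one : ∀ w (G : List (Clause 1)) → (∀ c → c ∈ G → width c ≡ k) → length G ≤ w →
    CoveredBy Good 1 (FreeIn G)
  containers-one w G widthG G≤w with sparse-or-dense G
  ... | inj₁ sparse = covered-by-itself G ≤-refl (widthG , sparse)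
  ... | inj₂ ((a , B) , B∈ , dense) with proj₂ (dense⇒nonempty {B = B} G dense)
  ...   | e , e∈ with ∈-copies B G e∈
  ...     | σ , _ , em = step w G≤w e (size≤1 B∈ σ (embeds⇒injective B G σ em)) (copies⊆ B G e e∈)
              (λ F PF → freeIn⇒independent G B∈ F PF e e∈)
    where
    step : ∀ w → length G ≤ w → ∀ {s} (e : Vec (Clause 1) s) → s ≤ 1 → VAll (_∈ G) e →
      (∀ F → FreeIn G F → ¬ VAll (λ c → F c ≡ true) e) → CoveredBy Good 1 (FreeIn G)
    step w       G≤w []       _ _        ind = covered-empty λ F PF → ind F PF []
    step zero    G≤w (c ∷ []) _ (c∈ ∷ _) ind = contradiction (≤-trans (∈-length c∈) G≤w) λ ()
    step (suc w) G≤w (c ∷ []) _ (c∈ ∷ _) ind = covered-mono ≤-refl (λ F PF → freeIn-remaining u G F (PF , avoids F PF))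
      (containers-one w (remaining u G) (remaining-width u G widthG)
        (≤-pred (≤-trans (+-monoˡ-≤ _ removed) (≤-trans (≤-reflexive (length-remaining u G)) G≤w))))
      where
      u : Clause 1 → Bool
      u c′ = ⌊ c ≟ᶜ c′ ⌋
      removed : 1 ≤ count u G
      removed = subst (λ b → 𝟙 b ≤ count u G) (Patterns.≟-refl _≟ᶜ_ c) (∑-elem (λ c′ → 𝟙 (u c′)) c∈)
      avoids : ∀ F → FreeIn G F → Avoids u G F
      avoids F PF c′ _ uc′ with F c′ in eq | Patterns.≟-true _≟ᶜ_ c c′ uc′
      ... | false | _    = refl
      ... | true  | refl = ⊥-elim (ind F PF (eq ∷ []))
    step w G≤w (_ ∷ _ ∷ _) (s≤s ()) _ _

  module Stages (ν t x : ℕ) (1≤t : 1 ≤ t) (root : t ^ (maxSize 𝓑 ∸ 1) ≤ suc ν) (N≤xt : suc ν ^ k ≤ x * t) where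

    n N M : ℕ
    n = suc ν
    N = n ^ k
    M = suc (Q * N)

    1≤N : 1 ≤ N
    1≤N = pos-^ {n} (s≤s z≤n) k

    1≤Q : 1 ≤ Q
    1≤Q = pos-^ {2} (s≤s z≤n) k

    stage : ℕ → ℕ
    stage w = w * (x * totalDepth)

    shrink-dense : ∀ w (G : List (Clause n)) → (∀ c → c ∈ G → width c ≡ k) → length G ≤ Q * N →
      ∀ {a} (B : Formula a) → (a , B) ∈ 𝓑 → ¬ Sparse G (a , B) →
      Continuation Good (FreeIn G) G N totalLoss (M ^ stage w) →
      CoveredBy Good (M ^ stage (suc w)) (FreeIn G)
    shrink-dense w G widthG G≤ {a} B B∈ dense cont with 1 ≤? size B | dense⇒nonempty {B = B} G dense
    -- Without clauses there is only the empty edge, which every `F` contains. In the other case a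
    -- clause supplies `k` variables, which makes `v ∸ k` a true difference.
    ... | no empty | _ , e , e∈ = covered-empty λ F PF → freeIn⇒independent G B∈ F PF e e∈ (trivial (n<1⇒n≡0 (≰⇒> empty)) e)
      where
      trivial : ∀ {X : Set} {P : X → Set} {s} → s ≡ 0 → (e : Vec X s) → VAll P e
      trivial refl [] = []
    ... | yes 1≤size | many , _ = covered-mono (^-monoʳ-≤ M deeper) (λ F PF → PF)
        (Shrinking.shrink _≟ᶜ_ t D N Q 1≤t 1≤D 1≤N 1≤Q G x M totalLoss (stage w) N≤xt (s≤s G≤) G≤ cont
          (size B) 0 (k ^ a) q (copies B G) (FreeIn G) (pos-^ 1≤k a) 1≤q (∑-elem lossOf B∈)
          (copies-capped t 1≤t (≤-trans (^-monoʳ-≤ t {{>-nonZero 1≤t}} (∸-monoˡ-≤ 1 (size≤maxSize B∈))) root))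
          saturated (copies⊆ B G) (λ F PF → PF) (freeIn⇒independent G B∈))
      where
      ksat = proj₁ (All.lookup hyp B∈)
      simple = proj₂ (All.lookup hyp B∈)
      open SimpleFormula k B ksat simple
      open Degrees ν k 1≤k B ksat simple G widthG using (copies-capped)
      open ≤-Reasoning
      v = numVars B
      D = t * n ^ (v ∸ k)
      1≤D : 1 ≤ D
      1≤D = pos-* 1≤t (pos-^ {n} (s≤s z≤n) (v ∸ k))
      deeper : stage w + x * depthOf (a , B) ≤ stage (suc w)
      deeper = ≤-trans (+-monoʳ-≤ (stage w) (*-monoʳ-≤ x (∑-elem depthOf B∈))) (≤-reflexive (+-comm (stage w) _))
      l₀ : Fin (size B)
      l₀ = fromℕ< 1≤size
      k≤v : k ≤ v
      k≤v = ≤-trans (≤-reflexive (sym (clause-size l₀))) (≤-trans (m≤m+n _ _) (free-vars-count (occurs (clause l₀)) (clause-uses l₀)))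
      saturated : D * N ≤ q * (t ^ 1 * length (copies B G))
      saturated = begin
        t * n ^ (v ∸ k) * n ^ k        ≡⟨ *-assoc t _ _ ⟩
        t * (n ^ (v ∸ k) * n ^ k)      ≡⟨ cong (t *_) (^-distribˡ-+-* n (v ∸ k) k) ⟨
        t * n ^ (v ∸ k + k)            ≡⟨ cong (λ j → t * n ^ j) (m∸n+n≡m k≤v) ⟩
        t * n ^ v                      ≤⟨ *-monoʳ-≤ t many ⟩
        t * (q * length (copies B G))  ≡⟨ shuffle t q _ ⟩
        q * (t ^ 1 * length (copies B G)) ∎
        where
        shuffle : ∀ t q l → t * (q * l) ≡ q * (t * 1 * l)
        shuffle = solve-∀

    -- `w` bounds the misses still possible: each removes at least `N / totalLoss` clauses and so
    -- lowers `length G * totalLoss` by `N`. At `w = 0` a further miss is contradictory.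
    containers : ∀ w (G : List (Clause n)) → (∀ c → c ∈ G → width c ≡ k) → length G ≤ Q * N →
      length G * totalLoss ≤ w * N → CoveredBy Good (M ^ stage (suc w)) (FreeIn G)
    containers w G widthG G≤ measure with sparse-or-dense G
    ... | inj₁ sparse = covered-by-itself G (pos-^ {M} (s≤s z≤n) (stage (suc w))) (widthG , sparse)
    ... | inj₂ ((a , B) , B∈ , dense) = shrink-dense w G widthG G≤ B B∈ dense (continue w measure)
      where
      open ≤-Reasoning
      continue : ∀ w → length G * totalLoss ≤ w * N → Continuation Good (FreeIn G) G N totalLoss (M ^ stage w)
      continue zero measure u N≤ = contradiction (begin
        1                       ≤⟨ 1≤N ⟩
        N                       ≤⟨ N≤ ⟩
        totalLoss * count u G   ≤⟨ *-monoʳ-≤ totalLoss (count≤length u G) ⟩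
        totalLoss * length G    ≡⟨ *-comm totalLoss _ ⟩
        length G * totalLoss    ≤⟨ measure ⟩
        0                       ∎) λ ()
      continue (suc w) measure u N≤ = covered-mono ≤-refl (freeIn-remaining u G)
        (containers w (remaining u G) (remaining-width u G widthG)
          (≤-trans (≤-trans (m≤n+m _ (count u G)) (≤-reflexive (length-remaining u G))) G≤)
          (+-cancelˡ-≤ N _ _ (begin
            N + length (remaining u G) * totalLoss                        ≤⟨ +-monoˡ-≤ _ N≤ ⟩
            totalLoss * count u G + length (remaining u G) * totalLoss    ≡⟨ shuffle totalLoss (count u G) (length (remaining u G)) ⟩
            (count u G + length (remaining u G)) * totalLoss              ≡⟨ cong (_* totalLoss) (length-remaining u G) ⟩
            length G * totalLoss                                          ≤⟨ measure ⟩
            N + w * N                                                     ∎)))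
        where
        shuffle : ∀ A c r → A * c + r * A ≡ (c + r) * A
        shuffle = solve-∀

  -- The family for all clauses of width `k` and its exponent

  vertices : ∀ n → List (Clause n)
  vertices n = filterᵇ (λ c → width c ≡ᵇ k) (allClauses n)

  vertices-width : ∀ n c → c ∈ vertices n → width c ≡ k
  vertices-width n c c∈ = ≡ᵇ⇒≡ (width c) k (≡⇒T (proj₂ (∈-filterᵇ⁻ (λ c → width c ≡ᵇ k) {xs = allClauses n} c∈)))

  ∈-vertices : ∀ {n} c → width c ≡ k → c ∈ vertices n
  ∈-vertices c w = ∈-filterᵇ⁺ (λ c → width c ≡ᵇ k) (allClauses-complete c) (T⇒≡ (≡⇒≡ᵇ (width c) k w))

  length-vertices : ∀ n → length (vertices n) ≤ Q * n ^ k
  length-vertices n = ≤-trans (≤-reflexive (length-filterᵇ _ (allClauses n)))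
    (≤-trans (count-width n k) (≤-reflexive (^-distribʳ-* k 2 n)))

  -- `suc (k + k)` comes from `fingerprint-base`, `suc (Q * totalLoss)` is the number of stages, and
  -- `totalDepth` bounds the hits per stage in units of `x`. The outer `suc` keeps the constant
  -- positive.
  constant : ℕ
  constant = suc (suc (k + k) * (suc (Q * totalLoss) * totalDepth))

  cover : 2 ≤ maxSize 𝓑 → ∀ ν → ∃[ c ] (CoveredBy Good c (FreeIn (vertices (suc ν))) ×
    PowBound (4 * constant) k (maxSize 𝓑) (suc ν) c)
  cover _ zero = 1 , containers-one _ (vertices 1) (vertices-width 1) ≤-refl ,
    λ a b _ _ → ≤-reflexive (trans (^-zeroˡ a) (sym (^-zeroˡ b)))
  cover 2≤m ν@(suc _) with integer-root (maxSize 𝓑 ∸ 1) (suc ν) (∸-monoˡ-≤ 1 2≤m) (s≤s z≤n)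
  ... | t , 1≤t , low , high =
      suc (Q * n ^ k) ^ (suc (Q * totalLoss) * (x * totalDepth)) ,
      Stages.containers ν t x 1≤t low N≤xt (Q * totalLoss) (vertices n) (vertices-width n) (length-vertices n) measure ,
      power-bound constant k (maxSize 𝓑) n t x _ 1≤k 2≤m (s≤s z≤n) high xt≤ count≤
    where
    open ≤-Reasoning
    instance
      t≢0 : NonZero t
      t≢0 = >-nonZero 1≤t
    n = suc ν
    -- An upper rounding of `n ^ k / t`: the extra one adds `t` to `x * t`, and `t ≤ n ^ k` keeps
    -- the total within `2 * n ^ k`.
    x = suc (n ^ k / t)
    N≤xt : n ^ k ≤ x * t
    N≤xt = ≤-trans (≤-reflexive (m≡m%n+[m/n]*n (n ^ k) t)) (+-monoˡ-≤ (n ^ k / t * t) (<⇒≤ (m%n<n (n ^ k) t)))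
    t≤n^k : t ≤ n ^ k
    t≤n^k = begin
      t                      ≡⟨ ^-identityʳ t ⟨
      t ^ 1                  ≤⟨ ^-monoʳ-≤ t (∸-monoˡ-≤ 1 2≤m) ⟩
      t ^ (maxSize 𝓑 ∸ 1)    ≤⟨ low ⟩
      n                      ≡⟨ ^-identityʳ n ⟨
      n ^ 1                  ≤⟨ ^-monoʳ-≤ n 1≤k ⟩
      n ^ k                  ∎
    xt≤ : x * t ≤ 2 * n ^ k
    xt≤ = begin
      t + n ^ k / t * t      ≤⟨ +-mono-≤ t≤n^k (m/n*n≤m (n ^ k) t) ⟩
      n ^ k + n ^ k          ≡⟨ cong (n ^ k +_) (+-identityʳ _) ⟨
      2 * n ^ k              ∎
    measure : length (vertices n) * totalLoss ≤ Q * totalLoss * n ^ k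
    measure = ≤-trans (*-monoˡ-≤ totalLoss (length-vertices n)) (≤-reflexive (shuffle Q (n ^ k) totalLoss))
      where
      shuffle : ∀ Q N A → Q * N * A ≡ Q * A * N
      shuffle = solve-∀
    E₀ = suc (Q * totalLoss) * totalDepth
    count≤ : suc (Q * n ^ k) ^ (suc (Q * totalLoss) * (x * totalDepth)) ≤ n ^ (constant * x)
    count≤ = begin
      suc (Q * n ^ k) ^ (suc (Q * totalLoss) * (x * totalDepth))  ≤⟨ ^-monoˡ-≤ (suc (Q * totalLoss) * (x * totalDepth)) (fingerprint-base k n (s≤s (s≤s z≤n))) ⟩
      (n ^ suc (k + k)) ^ (suc (Q * totalLoss) * (x * totalDepth)) ≡⟨ ^-*-assoc n (suc (k + k)) (suc (Q * totalLoss) * (x * totalDepth)) ⟩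
      n ^ (suc (k + k) * (suc (Q * totalLoss) * (x * totalDepth))) ≡⟨ cong (n ^_) (shuffle (suc (k + k)) (suc (Q * totalLoss)) x totalDepth) ⟩
      n ^ (suc (k + k) * E₀ * x)                                  ≤⟨ ^-monoʳ-≤ n (*-monoˡ-≤ x (n≤1+n (suc (k + k) * E₀))) ⟩
      n ^ (constant * x)                                          ∎
      where
      shuffle : ∀ a b x d → a * (b * (x * d)) ≡ a * (b * d) * x
      shuffle = solve-∀

powBound-mono : ∀ {C k m n M N} → N ≤ M → PowBound C k m n M → PowBound C k m n N
powBound-mono N≤M bound a b 1≤a lt = ≤-trans (^-monoˡ-≤ a N≤M) (bound a b 1≤a lt)

theorem3p5 : (k : ℕ) → 1 ≤ k →
    (𝓑 : List AnyFormula) →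
    All (λ B → IsKSAT k (proj₂ B) × Simple (proj₂ B)) 𝓑 →
    2 ≤ maxSize 𝓑 →
    (p q : ℕ) → 1 ≤ p → 1 ≤ q →
    ∃[ C ] (1 ≤ C ×
    ((n : ℕ) → 1 ≤ n →
    ∃[ 𝓖 ] (All (IsKSAT k {n}) 𝓖 ×
    ((F : Formula n) → IsKSAT k F → Free 𝓑 F → Any (F ⊆F_) 𝓖) ×
    All (λ G → All (λ B → CopiesBound p q B G) 𝓑) 𝓖 ×
    PowBound C k (maxSize 𝓑) n (length 𝓖))))
theorem3p5 k 1≤k 𝓑 hyp 2≤m p q 1≤p 1≤q = 4 * constant , s≤s z≤n , λ {
  (suc ν) _ → let c , (𝓒 , len , good , covers) , bound = cover 2≤m ν in
    map toFormula 𝓒 ,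
    All.map⁺ (All.map (λ {G} (widthG , _) c Gc → widthG c (toFormula⇒∈ G c Gc)) good) ,
    (λ F ksat free → Any.map⁺ (Any.map (λ {G} F⊆G c Fc → ∈⇒toFormula G c (F⊆G c Fc))
      (covers F (free , λ c Fc → ∈-vertices c (ksat c Fc))))) ,
    All.map⁺ (All.map (λ {G} (_ , sparse) → All.map (λ {(_ , B)} → copies-bound p q B G) sparse) good) ,
    powBound-mono {4 * constant} {k} {maxSize 𝓑} (≤-trans (≤-reflexive (length-map toFormula 𝓒)) len) bound }
  where open Containers k 1≤k 𝓑 hyp p q 1≤p 1≤q
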